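{- Let $G=(V,E)$ be a graph with $|V|=n>6$, and let $\mathcal C$ be a set of $k$ cycles of $G$ of lengths $n_1,\dots,n_k$ that induces a generalized $(n_1,\dots,n_k)$-puzzle on $V$. Then the configuration group generated by $\mathcal C$ is the alternating group $A_n$ if $n_1,\dots,n_k$ are all odd, and it is the symmetric group $S_n$ otherwise. Moreover, every permutation in the configuration group can be generated in $O(n^5)$ shifts.
   Context: A cycle $C=(v_1,\dots,v_j)$ of $G$ (a cyclic sequence of $j\geq 2$ distinct vertices with consecutive ones adjacent) is identified with the cyclic permutation $(v_1\ v_2\ \dots\ v_j)$ of $V$; a shift along $C$ means composing the current permutation with this cycle or its inverse. The configuration group is the subgroup of $S_n$ generated by the cycles in $\mathcal C$. "A permutation can be generated in $N$ shifts" means it is a product of at most $N$ factors, each a cycle of $\mathcal C$ or its inverse. Two cycles are properly interconnected if they share exactly one vertex, or share exactly two vertices which are consecutive in both cycles. The interconnection graph $\hat G$ has vertex set $\mathcal C$, with an edge between two cycles iff they are properly interconnected. Assuming $|V|>6$, $\mathcal C$ induces a generalized $(n_1,\dots,n_k)$-puzzle on $V$ if there is a subset $\mathcal C'\subseteq\mathcal C$ such that: $\mathcal C'$ contains at least two cycles; the induced subgraph $\hat G[\mathcal C']$ is connected; every vertex of $G$ lies on at least one cycle of $\mathcal C'$. -}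

module Defs where

open import Data.Nat using (ℕ; zero; suc; _+_; _%_; _≤_; _<_)
open import Data.Nat.DivMod using (_mod_)
open import Data.Fin using (Fin; toℕ)
open import Data.Fin.Properties using (any?) renaming (_≟_ to _≟ᶠ_)
open import Data.Fin.Subset using (Subset; _∈_)
open import Data.Fin.Permutation using (Permutation′; _⟨$⟩ʳ_; transpose)
open import Data.List using (List; []; _∷_; length)
open import Data.Bool using (Bool; true; false)
open import Data.Product using (Σ; ∃; _×_; _,_; proj₁)
open import Data.Sum using (_⊎_)
open import Relation.Nullary using (¬_; yes; no)
open import Relation.Binary.PropositionalEquality using (_≡_; _≢_)
open import Function using (id; _∘_)

record Graph (n : ℕ) : Set₁ where
  field
    Adj    : Fin n → Fin n → Set
    sym    : ∀ {u v} → Adj u v → Adj v u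
    irrefl : ∀ {u} → ¬ Adj u u

next : ∀ {j : ℕ} → .{{_ : Data.Nat.NonZero j}} → Fin j → Fin j
next {j} i = (suc (toℕ i)) mod j

prev : ∀ {j : ℕ} → .{{_ : Data.Nat.NonZero j}} → Fin j → Fin j
prev {j} i = (toℕ i + (j Data.Nat.∸ 1)) mod j

record Cycle {n : ℕ} (G : Graph n) : Set where
  field
    ext      : ℕ
  len : ℕ
  len = suc (suc ext)
  field
    vs       : Fin len → Fin n
    distinct : ∀ i j → vs i ≡ vs j → i ≡ j
    adjacent : ∀ i → Graph.Adj G (vs i) (vs (next i))

open Cycle public

module _ {n : ℕ} {G : Graph n} where

  OnCycle : Fin n → Cycle G → Set
  OnCycle v c = ∃ λ i → vs c i ≡ v

  Consecutive : Cycle G → Fin n → Fin n → Set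
  Consecutive c u v = ∃ λ i → (vs c i ≡ u × vs c (next i) ≡ v)
                            ⊎ (vs c i ≡ v × vs c (next i) ≡ u)

  ProperlyInterconnected : Cycle G → Cycle G → Set
  ProperlyInterconnected c d =
      (∃ λ v → OnCycle v c × OnCycle v d
             × (∀ w → OnCycle w c → OnCycle w d → w ≡ v))
    ⊎ (∃ λ u → ∃ λ v → u ≢ v
             × OnCycle u c × OnCycle u d × OnCycle v c × OnCycle v d
             × (∀ w → OnCycle w c → OnCycle w d → w ≡ u ⊎ w ≡ v)
             × Consecutive c u v × Consecutive d u v)

  cyclePerm : Cycle G → Fin n → Fin n
  cyclePerm c v with any? (λ i → vs c i ≟ᶠ v)
  ... | yes (i , _) = vs c (next i)
  ... | no _        = v

  cyclePermInv : Cycle G → Fin n → Fin n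
  cyclePermInv c v with any? (λ i → vs c i ≟ᶠ v)
  ... | yes (i , _) = vs c (prev i)
  ... | no _        = v

module _ {n k : ℕ} {G : Graph n} (𝒞 : Fin k → Cycle G) where

  Shift : Set
  Shift = Fin k × Bool

  shift : Shift → Fin n → Fin n
  shift (i , true)  = cyclePerm (𝒞 i)
  shift (i , false) = cyclePermInv (𝒞 i)

  evalWord : List Shift → Fin n → Fin n
  evalWord []      = id
  evalWord (s ∷ w) = shift s ∘ evalWord w

  Generates : List Shift → Permutation′ n → Set
  Generates w π = ∀ v → evalWord w v ≡ π ⟨$⟩ʳ v

  InConfigGroup : Permutation′ n → Set
  InConfigGroup π = ∃ λ w → Generates w π

  data PathIn (S : Subset k) : Fin k → Fin k → Set where
    here : ∀ {i} → PathIn S i i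
    step : ∀ {i j l} → ProperlyInterconnected (𝒞 i) (𝒞 j) → j ∈ S
         → PathIn S j l → PathIn S i l

  InducesPuzzle : Set
  InducesPuzzle = ∃ λ (S : Subset k) →
      (∃ λ i → ∃ λ j → i ≢ j × i ∈ S × j ∈ S)
    × (∀ i j → i ∈ S → j ∈ S → PathIn S i j)
    × (∀ v → ∃ λ i → i ∈ S × OnCycle v (𝒞 i))

composeTranspositions : ∀ {n} → List (Fin n × Fin n) → Fin n → Fin n
composeTranspositions []            = id
composeTranspositions ((a , b) ∷ t) =
  (transpose a b ⟨$⟩ʳ_) ∘ composeTranspositions t

data AllDistinctPairs {n : ℕ} : List (Fin n × Fin n) → Set where
  []  : AllDistinctPairs []
  _∷_ : ∀ {a b t} → a ≢ b → AllDistinctPairs t → AllDistinctPairs ((a , b) ∷ t)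

IsEven : ∀ {n} → Permutation′ n → Set
IsEven {n} π = ∃ λ (t : List (Fin n × Fin n)) →
    AllDistinctPairs t × length t % 2 ≡ 0
  × (∀ v → composeTranspositions t v ≡ π ⟨$⟩ʳ v)

OddNat : ℕ → Set
OddNat m = m % 2 ≡ 1

{-# OPTIONS --safe #-}

-- Two permutations whose supports meet in one point have a 3-cycle as commutator. Cycles sharing one
-- vertex give a 3-cycle in this way, and so do cycles sharing an edge after a few conjugations, except
-- when both have length 2 or both have length 4; since n > 6, a third cycle then helps out. The points
-- joined by 3-cycles of the group form blocks, and a block spreads along properly interconnected cycles,
-- so it is everything and the group contains all 3-cycles. One 3-cycle has a word of bounded length;
-- every other one is a conjugate of it, by a word that may be cut down to length n³ because it only
-- matters on a triple of points. A permutation is a product of at most n transpositions, hence, when it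
-- is even, of at most n 3-cycles; an odd one is first made even by a shift that is itself odd.
module Submission where

open import Defs
open import Data.Bool using (Bool; true; false; not)
open import Data.Nat using (ℕ; zero; suc; _+_; _∸_; _*_; _^_; _⊓_; _≤_; _<_; _%_; z≤n; s≤s; NonZero; >-nonZero)
open import Data.Nat.DivMod using (_mod_; m%n<n; m%n%n≡m%n; %-distribˡ-+; [m+n]%n≡m%n; m<n⇒m%n≡m; m≤n⇒[n∸m]%m≡n%m)
import Data.Nat.Properties as ℕ
open import Data.Nat.Solver using (module +-*-Solver)
open import Data.Fin using (Fin; toℕ; combine; #_)
open import Data.Fin.Properties using (pigeonhole; any?; all?; ¬∀⟶∃¬; toℕ<n; toℕ-injective; toℕ-fromℕ<; injective⇒≤; combine-injective) renaming (_≟_ to _≟ᶠ_)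
open import Data.Fin.Permutation using (Permutation′; permutation; _⟨$⟩ʳ_; _⟨$⟩ˡ_; _∘ₚ_; remove; transpose)
import Data.Fin.Permutation.Components as PC
open import Data.Fin.Permutation.Transposition.List using (TranspositionList; eval; decompose; eval-decompose)
open import Data.Fin.Subset using (Subset; _∈_)
open import Data.List using (List; []; _∷_; _++_; [_]; length; replicate; take; drop)
open import Data.List.Properties using (length-++; length-map; length-replicate; take++drop≡id; length-take; length-drop)
open import Data.Vec using (Vec; []; _∷_; lookup)
open import Data.Vec.Relation.Unary.All using ([]; _∷_)
open import Data.Vec.Relation.Unary.AllPairs using ([]; _∷_)
open import Data.Vec.Relation.Unary.Unique.Propositional using (Unique)
open import Data.Vec.Relation.Unary.Unique.Propositional.Properties using (lookup-injective)
open import Data.Product using (Σ; ∃; _×_; _,_; proj₁; proj₂)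
open import Data.Sum using (_⊎_; inj₁; inj₂; swap; [_,_]′)
open import Relation.Nullary using (¬_; Dec; yes; no; contradiction; ¬?)
open import Relation.Binary.PropositionalEquality using (_≡_; _≢_; refl; sym; trans; cong; cong₂; subst; subst₂; module ≡-Reasoning)
open import Function using (_∘_; id)
open import Function.Bundles using (_⇔_; mk⇔)

-- Both exceptional pairs are genuine obstacles. Two cycles of length 2 on a common edge are the
-- same transposition. Two 4-cycles with a common edge cover six points, and these can be labelled
-- by the projective line over the field of five elements so that both cycles lie in PGL(2,5); there
-- only the identity fixes three points, so no 3-cycle can arise. A vertex off the pair is therefore
-- needed, and the 4-cycles are the reason for n > 6. A path of interconnected cycles towards such a
-- vertex must at some step leave the exceptional situation. Spreading the blocks says nothing about
-- the lengths of the words involved. Hence the 3-cycles are obtained twice: once without any bound,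
-- only to see that the group is transitive on triples of distinct points, and then again as
-- conjugates of the one short word. Parity is always witnessed by an explicit list of
-- transpositions, whose length also feeds the bound on the number of shifts.

opaque
  fresh : ∀ {m n} (xs : Vec (Fin n) m) → m < n → ∃ λ x → ∀ i → lookup xs i ≢ x
  fresh {m} {n} xs m<n with any? (λ x → all? (λ i → ¬? (lookup xs i ≟ᶠ x)))
  ... | yes found = found
  ... | no  none  = contradiction (pigeonhole m<n index) λ where
      (x , y , x<y , eq) → ℕ.<⇒≢ x<y (cong toℕ
        (trans (sym (proj₂ (located x))) (trans (cong (lookup xs) eq) (proj₂ (located y)))))
    where
    located : ∀ x → ∃ λ i → lookup xs i ≡ x
    located x with any? (λ i → lookup xs i ≟ᶠ x)
    ... | yes found = found
    ... | no  ¬found = contradiction (x , λ i eq → ¬found (i , eq)) none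
    index : Fin n → Fin m
    index = proj₁ ∘ located

-- Transpositions, 3-cycles and lists of transpositions

module _ {n : ℕ} where

  record IsThreeCycle (f : Fin n → Fin n) (a b c : Fin n) : Set where
    constructor threeCycle
    field
      a≢b : a ≢ b
      b≢c : b ≢ c
      c≢a : c ≢ a
      ab  : f a ≡ b
      bc  : f b ≡ c
      ca  : f c ≡ a
      fix : ∀ v → v ≢ a → v ≢ b → v ≢ c → f v ≡ v

  threeCycle-unique : ∀ {f g a b c} → IsThreeCycle f a b c → IsThreeCycle g a b c → ∀ v → f v ≡ g v
  threeCycle-unique {f} {g} {a} {b} {c} F G v with v ≟ᶠ a | v ≟ᶠ b | v ≟ᶠ c
  ... | yes refl | _ | _ = trans (F .IsThreeCycle.ab) (sym (G .IsThreeCycle.ab))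
  ... | no _ | yes refl | _ = trans (F .IsThreeCycle.bc) (sym (G .IsThreeCycle.bc))
  ... | no _ | no _ | yes refl = trans (F .IsThreeCycle.ca) (sym (G .IsThreeCycle.ca))
  ... | no p | no q | no r = trans (F .IsThreeCycle.fix v p q r) (sym (G .IsThreeCycle.fix v p q r))

  transpose-left : ∀ (a b : Fin n) → PC.transpose a b a ≡ b
  transpose-left a b with a ≟ᶠ a
  ... | yes _ = refl
  ... | no ¬p = contradiction refl ¬p

  transpose-right : ∀ (a b : Fin n) → PC.transpose a b b ≡ a
  transpose-right a b with b ≟ᶠ a
  ... | yes p = p
  ... | no _ with b ≟ᶠ b
  ... | yes _ = refl
  ... | no ¬p = contradiction refl ¬p

  transpose-fix : ∀ {a b v : Fin n} → v ≢ a → v ≢ b → PC.transpose a b v ≡ v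
  transpose-fix {a} {b} {v} v≢a v≢b with v ≟ᶠ a
  ... | yes p = contradiction p v≢a
  ... | no _ with v ≟ᶠ b
  ... | yes p = contradiction p v≢b
  ... | no _ = refl

  transpose-comm : ∀ (a b v : Fin n) → PC.transpose a b v ≡ PC.transpose b a v
  transpose-comm a b v = by (v ≟ᶠ a) (v ≟ᶠ b)
    where
    by : Dec (v ≡ a) → Dec (v ≡ b) → PC.transpose a b v ≡ PC.transpose b a v
    by (yes refl) _          = trans (transpose-left a b) (sym (transpose-right b a))
    by (no _)     (yes refl) = trans (transpose-right a b) (sym (transpose-left b a))
    by (no v≢a)   (no v≢b)   = trans (transpose-fix v≢a v≢b) (sym (transpose-fix v≢b v≢a))

  transpose-id : ∀ (a v : Fin n) → PC.transpose a a v ≡ v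
  transpose-id a v = by (v ≟ᶠ a)
    where
    by : Dec (v ≡ a) → PC.transpose a a v ≡ v
    by (yes refl) = transpose-left a a
    by (no v≢a)   = transpose-fix v≢a v≢a

  transpose-involutive : ∀ (a b v : Fin n) → PC.transpose a b (PC.transpose a b v) ≡ v
  transpose-involutive a b v =
    trans (cong (PC.transpose a b) (transpose-comm a b v)) (PC.transpose-inverse a b)

  transpose-transpose : ∀ {a b c : Fin n} → a ≢ b → b ≢ c → c ≢ a →
    IsThreeCycle (PC.transpose a b ∘ PC.transpose b c) a b c
  transpose-transpose {a} {b} {c} a≢b b≢c c≢a = record
    { a≢b = a≢b ; b≢c = b≢c ; c≢a = c≢a
    ; ab = trans (cong (PC.transpose a b) (transpose-fix a≢b (c≢a ∘ sym))) (transpose-left a b)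
    ; bc = trans (cong (PC.transpose a b) (transpose-left b c)) (transpose-fix c≢a (b≢c ∘ sym))
    ; ca = trans (cong (PC.transpose a b) (transpose-right b c)) (transpose-right a b)
    ; fix = λ v v≢a v≢b v≢c →
        trans (cong (PC.transpose a b) (transpose-fix v≢b v≢c)) (transpose-fix v≢a v≢b)
    }

  compose-++ : ∀ (t t′ : List (Fin n × Fin n)) v →
    composeTranspositions (t ++ t′) v ≡ composeTranspositions t (composeTranspositions t′ v)
  compose-++ []            t′ v = refl
  compose-++ ((a , b) ∷ t) t′ v = cong (PC.transpose a b) (compose-++ t t′ v)

  distinct-++ : ∀ {t t′ : List (Fin n × Fin n)} →
    AllDistinctPairs t → AllDistinctPairs t′ → AllDistinctPairs (t ++ t′)
  distinct-++ []       q = q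
  distinct-++ (a≢b ∷ p) q = a≢b ∷ distinct-++ p q

  rev : List (Fin n × Fin n) → List (Fin n × Fin n)
  rev []      = []
  rev (p ∷ t) = rev t ++ [ p ]

  length-rev : ∀ t → length (rev t) ≡ length t
  length-rev []      = refl
  length-rev (p ∷ t) = trans (length-++ (rev t)) (trans (ℕ.+-comm _ 1) (cong suc (length-rev t)))

  distinct-rev : ∀ {t} → AllDistinctPairs t → AllDistinctPairs (rev t)
  distinct-rev []        = []
  distinct-rev (a≢b ∷ p) = distinct-++ (distinct-rev p) (a≢b ∷ [])

  compose-rev : ∀ t v → composeTranspositions (rev t) (composeTranspositions t v) ≡ v
  compose-rev []            v = refl
  compose-rev ((a , b) ∷ t) v = trans (compose-++ (rev t) _ _)
    (trans (cong (composeTranspositions (rev t)) (transpose-involutive a b _)) (compose-rev t v))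

  compose-rev′ : ∀ (t : List (Fin n × Fin n)) v → composeTranspositions t (composeTranspositions (rev t) v) ≡ v
  compose-rev′ []            v = refl
  compose-rev′ ((a , b) ∷ t) v =
    trans (cong (PC.transpose a b ∘ composeTranspositions t) (compose-++ (rev t) _ v))
      (trans (cong (PC.transpose a b) (compose-rev′ t _)) (transpose-involutive a b v))

  -- `eval` applies the head of its list first and `composeTranspositions` applies it last, so each
  -- pair goes to the end. Pairs of equal points are dropped, which is why the length may shrink.
  eval-compose : ∀ (l : TranspositionList n) → ∃ λ t → AllDistinctPairs t × length t ≤ length l
    × (∀ v → composeTranspositions t v ≡ eval l ⟨$⟩ʳ v)
  eval-compose [] = [] , [] , z≤n , λ _ → refl
  eval-compose ((i , j) ∷ l) with eval-compose l | i ≟ᶠ j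
  ... | t , dt , t≤l , eq | no i≢j =
      t ++ [ i , j ] , distinct-++ dt (i≢j ∷ [])
    , subst (_≤ _) (sym (trans (length-++ t) (ℕ.+-comm _ 1))) (s≤s t≤l)
    , λ v → trans (compose-++ t _ v) (eq _)
  ... | t , dt , t≤l , eq | yes refl =
      t , dt , ℕ.m≤n⇒m≤1+n t≤l
    , λ v → trans (eq v) (sym (cong (eval l ⟨$⟩ʳ_) (transpose-id i v)))

-- `decompose` spends exactly one pair, possibly a trivial one, on each point and goes on with
-- `rest`, the permutation left over on the other points.
length-decompose : ∀ {n} (π : Permutation′ n) → length (decompose π) ≡ n
length-decompose {zero}  π = refl
length-decompose {suc n} π =
  cong suc (trans (length-map _ (decompose rest)) (length-decompose rest))
  where
  rest : Permutation′ n
  rest = remove Fin.zero (transpose Fin.zero (π ⟨$⟩ˡ Fin.zero) ∘ₚ π)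

transpositions : ∀ {n} (π : Permutation′ n) → ∃ λ t → AllDistinctPairs t × length t ≤ n
  × (∀ v → composeTranspositions t v ≡ π ⟨$⟩ʳ v)
transpositions π with eval-compose (decompose π)
... | t , dt , t≤ , eq = t , dt , subst (length t ≤_) (length-decompose π) t≤
                       , λ v → trans (eq v) (eval-decompose π v)

-- Parity of lengths and the final estimate

%2-cases : ∀ m → m % 2 ≡ 0 ⊎ m % 2 ≡ 1
%2-cases 0             = inj₁ refl
%2-cases 1             = inj₂ refl
%2-cases (suc (suc m)) = %2-cases m

suc-odd : ∀ m → m % 2 ≡ 1 → suc m % 2 ≡ 0
suc-odd 1             p = refl
suc-odd (suc (suc m)) p = suc-odd m p

suc-even : ∀ m → m % 2 ≡ 0 → suc m % 2 ≡ 1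
suc-even 0             p = refl
suc-even (suc (suc m)) p = suc-even m p

even-+ : ∀ m {n} → m % 2 ≡ 0 → (m + n) % 2 ≡ n % 2
even-+ 0             p = refl
even-+ (suc (suc m)) p = even-+ m p

odd-+ : ∀ m {n} → m % 2 ≡ 1 → (m + n) % 2 ≡ suc n % 2
odd-+ 1             p = refl
odd-+ (suc (suc m)) p = odd-+ m p

-- At most 3n transpositions at a cost of n³ + 20 + n³ ≤ 22n³ each, and one odd shift: 3 · 22 + 1 =
-- 67. The count itself is of order n⁴; a further factor n is given away to reach the power in the
-- theorem.
polynomial-bound : ∀ n → .{{NonZero n}} → let N = n * (n * n) in
  1 + (n + n + n) * (N + (20 + N)) ≤ 67 * n ^ 5
polynomial-bound n = begin
  1 + (n + n + n) * (N + (20 + N))         ≤⟨ ℕ.+-mono-≤ (ℕ.m^n>0 n 5) (ℕ.*-monoʳ-≤ (n + n + n) M≤) ⟩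
  n ^ 5 + (n + n + n) * (N + (20 * N + N)) ≡⟨ cong (n ^ 5 +_) (expand n) ⟩
  n ^ 5 + 66 * (n * N)                     ≤⟨ ℕ.+-monoʳ-≤ (n ^ 5) (ℕ.*-monoʳ-≤ 66 (ℕ.m≤m*n (n * N) n)) ⟩
  n ^ 5 + 66 * (n * N * n)                 ≡⟨ cong (λ x → n ^ 5 + 66 * x) (power n) ⟩
  67 * n ^ 5                               ∎
  where
  open ℕ.≤-Reasoning
  open +-*-Solver
  N = n * (n * n)
  instance
    n²≢0 : NonZero (n * n)
    n²≢0 = ℕ.m*n≢0 n n
    N≢0 : NonZero N
    N≢0 = ℕ.m*n≢0 n (n * n)
  M≤ : N + (20 + N) ≤ N + (20 * N + N)
  M≤ = ℕ.+-monoʳ-≤ N (ℕ.+-monoˡ-≤ N (ℕ.m≤m*n 20 N))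
  expand : ∀ x → (x + x + x) * (x * (x * x) + (20 * (x * (x * x)) + x * (x * x))) ≡ 66 * (x * (x * (x * x)))
  expand = solve 1 (λ x →
    (x :+ x :+ x) :* (x :* (x :* x) :+ (con 20 :* (x :* (x :* x)) :+ x :* (x :* x)))
      := con 66 :* (x :* (x :* (x :* x)))) refl
  power : ∀ x → x * (x * (x * x)) * x ≡ x ^ 5
  power = solve 1 (λ x → x :* (x :* (x :* x)) :* x := x :^ 5) refl

-- Residues modulo the length of a cycle

module _ (d : ℕ) .{{_ : NonZero d}} where

  %-absorbʳ : ∀ k m → (k + m % d) % d ≡ (k + m) % d
  %-absorbʳ k m = trans (%-distribˡ-+ k (m % d) d)
    (trans (cong (λ r → (k % d + r) % d) (m%n%n≡m%n m d)) (sym (%-distribˡ-+ k m d)))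

  mod-cong : ∀ a b → a % d ≡ b % d → a mod d ≡ b mod d
  mod-cong a b eq = toℕ-injective
    (trans (toℕ-fromℕ< (m%n<n a d)) (trans eq (sym (toℕ-fromℕ< (m%n<n b d)))))

  mod-injective : ∀ a b → a mod d ≡ b mod d → a % d ≡ b % d
  mod-injective a b eq =
    trans (sym (toℕ-fromℕ< (m%n<n a d))) (trans (cong toℕ eq) (toℕ-fromℕ< (m%n<n b d)))

  toℕ-mod : ∀ i → toℕ {d} i mod d ≡ i
  toℕ-mod i = toℕ-injective (trans (toℕ-fromℕ< (m%n<n (toℕ i) d)) (m<n⇒m%n≡m (toℕ<n i)))

  next-mod : ∀ m → next (m mod d) ≡ suc m mod d
  next-mod m = mod-cong _ (suc m) (trans (cong (λ r → suc r % d) (toℕ-fromℕ< (m%n<n m d))) (%-absorbʳ 1 m))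

  -- With r the residue of m, the sum k + r is below 2d, so its residue is k + r or k + r - d.
  -- Equality with r would force k = 0 or k = d.
  shift-≢ : ∀ k m → 0 < k → k < d → (k + m) % d ≢ m % d
  shift-≢ k m 0<k k<d eq = by (k + r ℕ.<? d)
    where
    r = m % d
    eq′ : (k + r) % d ≡ r
    eq′ = trans (%-absorbʳ k m) eq
    by : ¬ Dec (k + r < d)
    by (yes k+r<d) = ℕ.<⇒≢ 0<k (sym (ℕ.m+n≡0⇒m≡0 k (ℕ.+-cancelʳ-≡ r _ _
      (trans (cong (_+ r) (ℕ.+-identityʳ k)) (trans (sym (m<n⇒m%n≡m k+r<d)) eq′)))))
    by (no k+r≮d) = ℕ.<⇒≢ k<d (ℕ.+-cancelʳ-≡ r _ _
      (trans (sym (ℕ.m∸n+n≡m d≤k+r)) (trans (cong (_+ d) k+r∸d≡r) (ℕ.+-comm r d))))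
      where
      d≤k+r : d ≤ k + r
      d≤k+r = ℕ.≮⇒≥ k+r≮d
      k+r∸d≡r : k + r ∸ d ≡ r
      k+r∸d≡r = trans (sym (m<n⇒m%n≡m
          (ℕ.m<n+o⇒m∸n<o (k + r) d (ℕ.+-mono-< k<d (m%n<n m d)))))
        (trans (m≤n⇒[n∸m]%m≡n%m d≤k+r) eq′)

-- For length d + 1 the function `prev` adds d, which together with the successor makes one full
-- turn.
prev-mod : ∀ d m → prev (suc m mod suc d) ≡ m mod suc d
prev-mod d m = mod-cong (suc d) (toℕ (suc m mod suc d) + d) m (begin
  (toℕ (suc m mod suc d) + d) % suc d ≡⟨ cong (λ r → (r + d) % suc d) (toℕ-fromℕ< (m%n<n (suc m) (suc d))) ⟩
  (suc m % suc d + d) % suc d         ≡⟨ cong (_% suc d) (ℕ.+-comm (suc m % suc d) d) ⟩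
  (d + suc m % suc d) % suc d         ≡⟨ %-absorbʳ (suc d) d (suc m) ⟩
  (d + suc m) % suc d                 ≡⟨ cong (_% suc d) (trans (ℕ.+-suc d m) (ℕ.+-comm (suc d) m)) ⟩
  (m + suc d) % suc d                 ≡⟨ [m+n]%n≡m%n m (suc d) ⟩
  m % suc d                           ∎)
  where open ≡-Reasoning

-- Cycles as permutations and as products of transpositions

module _ {n : ℕ} {G : Graph n} (c : Cycle G) where

  -- Numbering the vertices by all natural numbers lets powers of the cycle act by plain addition.
  pos : ℕ → Fin n
  pos m = vs c (m mod len c)

  opaque
    onCycle? : ∀ v → Dec (OnCycle v c)
    onCycle? v = any? (λ i → vs c i ≟ᶠ v)

  pos-on : ∀ m → OnCycle (pos m) c
  pos-on m = m mod len c , refl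

  on⇒pos : ∀ {v} → OnCycle v c → ∃ λ m → m < len c × pos m ≡ v
  on⇒pos (i , eq) = toℕ i , toℕ<n i , trans (cong (vs c) (toℕ-mod (len c) i)) eq

  pos-≢ : ∀ k m → 0 < k → k < len c → pos (k + m) ≢ pos m
  pos-≢ k m 0<k k<d eq = shift-≢ (len c) k m 0<k k<d (mod-injective (len c) (k + m) m (distinct c _ _ eq))

  pos-period : ∀ m → pos (len c + m) ≡ pos m
  pos-period m = cong (vs c) (mod-cong (len c) (len c + m) m
    (trans (cong (_% len c) (ℕ.+-comm (len c) m)) ([m+n]%n≡m%n m (len c))))

  cyclePerm-vs : ∀ i → cyclePerm c (vs c i) ≡ vs c (next i)
  cyclePerm-vs i with any? (λ i′ → vs c i′ ≟ᶠ vs c i)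
  ... | yes (i′ , eq) = cong (vs c ∘ next) (distinct c i′ i eq)
  ... | no ¬on        = contradiction (i , refl) ¬on

  cyclePermInv-vs : ∀ i → cyclePermInv c (vs c i) ≡ vs c (prev i)
  cyclePermInv-vs i with any? (λ i′ → vs c i′ ≟ᶠ vs c i)
  ... | yes (i′ , eq) = cong (vs c ∘ prev) (distinct c i′ i eq)
  ... | no ¬on        = contradiction (i , refl) ¬on

  cyclePerm-off : ∀ {v} → ¬ OnCycle v c → cyclePerm c v ≡ v
  cyclePerm-off {v} ¬on with any? (λ i → vs c i ≟ᶠ v)
  ... | yes on = contradiction on ¬on
  ... | no _   = refl

  cyclePermInv-off : ∀ {v} → ¬ OnCycle v c → cyclePermInv c v ≡ v
  cyclePermInv-off {v} ¬on with any? (λ i → vs c i ≟ᶠ v)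
  ... | yes on = contradiction on ¬on
  ... | no _   = refl

  cyclePerm-pos : ∀ m → cyclePerm c (pos m) ≡ pos (suc m)
  cyclePerm-pos m = trans (cyclePerm-vs _) (cong (vs c) (next-mod (len c) m))

  cyclePermInv-pos : ∀ m → cyclePermInv c (pos (suc m)) ≡ pos m
  cyclePermInv-pos m = trans (cyclePermInv-vs _) (cong (vs c) (prev-mod (suc (ext c)) m))

  cyclePermInv-cyclePerm : ∀ v → cyclePermInv c (cyclePerm c v) ≡ v
  cyclePermInv-cyclePerm v with onCycle? v
  ... | no ¬on = trans (cong (cyclePermInv c) (cyclePerm-off ¬on)) (cyclePermInv-off ¬on)
  ... | yes on with on⇒pos on
  ... | m , _ , refl = trans (cong (cyclePermInv c) (cyclePerm-pos m)) (cyclePermInv-pos m)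

  cyclePerm-cyclePermInv : ∀ v → cyclePerm c (cyclePermInv c v) ≡ v
  cyclePerm-cyclePermInv v with onCycle? v
  ... | no ¬on = trans (cong (cyclePerm c) (cyclePermInv-off ¬on)) (cyclePerm-off ¬on)
  ... | yes on with on⇒pos on
  ... | m , _ , refl = begin
    -- A full turn is added because `cyclePermInv-pos` needs a successor and m may be 0.
    cyclePerm c (cyclePermInv c (pos m))           ≡⟨ cong (cyclePerm c ∘ cyclePermInv c) (pos-period m) ⟨
    cyclePerm c (cyclePermInv c (pos (len c + m))) ≡⟨ cong (cyclePerm c) (cyclePermInv-pos (suc (ext c) + m)) ⟩
    cyclePerm c (pos (suc (ext c) + m))            ≡⟨ cyclePerm-pos (suc (ext c) + m) ⟩
    pos (len c + m)                                ≡⟨ pos-period m ⟩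
    pos m                                          ∎
    where open ≡-Reasoning

  len≤n : len c ≤ n
  len≤n = injective⇒≤ (λ {i} {j} → distinct c i j)

  -- The standard factorization (p₀ p₁)(p₁ p₂)...(pₖ₋₁ pₖ) of the cycle (p₀ p₁ ... pₖ).
  path : ℕ → List (Fin n × Fin n)
  path zero    = []
  path (suc k) = path k ++ [ pos k , pos (suc k) ]

  length-path : ∀ k → length (path k) ≡ k
  length-path zero    = refl
  length-path (suc k) = trans (length-++ (path k)) (trans (ℕ.+-comm _ 1) (cong suc (length-path k)))

  pos-injective : ∀ a b → a < len c → b < len c → pos a ≡ pos b → a ≡ b
  pos-injective a b a< b< eq = trans (sym (m<n⇒m%n≡m a<))
    (trans (mod-injective (len c) a b (distinct c _ _ eq)) (m<n⇒m%n≡m b<))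

  distinct-path : ∀ k → AllDistinctPairs (path k)
  distinct-path zero    = []
  distinct-path (suc k) =
    distinct-++ (distinct-path k) (pos-≢ 1 k (s≤s z≤n) (s≤s (s≤s z≤n)) ∘ sym ∷ [])

  path-off : ∀ k v → (∀ m → m ≤ k → v ≢ pos m) → composeTranspositions (path k) v ≡ v
  path-off zero    v off = refl
  path-off (suc k) v off = trans (compose-++ (path k) _ v)
    (trans (cong (composeTranspositions (path k)) (transpose-fix (off k (ℕ.n≤1+n k)) (off (suc k) ℕ.≤-refl)))
      (path-off k v (λ m m≤k → off m (ℕ.m≤n⇒m≤1+n m≤k))))

  path-end : ∀ k → composeTranspositions (path k) (pos k) ≡ pos 0
  path-end zero    = refl
  path-end (suc k) = trans (compose-++ (path k) _ _)
    (trans (cong (composeTranspositions (path k)) (transpose-right (pos k) (pos (suc k)))) (path-end k))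

  -- Pairs act from the last to the first. So `pos m` meets its pair with `pos (suc m)` first, and
  -- the pairs still to come involve only positions up to m.
  path-step : ∀ k m → k < len c → m < k → composeTranspositions (path k) (pos m) ≡ pos (suc m)
  path-step (suc k) m k< (s≤s m≤k) with ℕ.m≤n⇒m<n∨m≡n m≤k
  ... | inj₂ refl = trans (compose-++ (path k) _ _)
    (trans (cong (composeTranspositions (path k)) (transpose-left (pos k) (pos (suc k))))
      (path-off k _ (λ i i≤k eq → ℕ.<⇒≢ (s≤s i≤k) (sym (pos-injective (suc k) i k< (ℕ.≤-<-trans i≤k (ℕ.<-trans (ℕ.n<1+n k) k<)) eq)))))
  ... | inj₁ m<k = trans (compose-++ (path k) _ _)
    (trans (cong (composeTranspositions (path k)) (transpose-fix
        (λ eq → ℕ.<⇒≢ m<k (pos-injective m k m<d k<d eq))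
        (λ eq → ℕ.<⇒≢ (ℕ.m<n⇒m<1+n m<k) (pos-injective m (suc k) m<d k< eq))))
      (path-step k m k<d m<k))
    where
    k<d : k < len c
    k<d = ℕ.<-trans (ℕ.n<1+n k) k<
    m<d : m < len c
    m<d = ℕ.<-trans m<k k<d

  cyclePerm-transpositions : ∀ v → composeTranspositions (path (suc (ext c))) v ≡ cyclePerm c v
  cyclePerm-transpositions v with onCycle? v
  ... | no ¬on = trans (path-off (suc (ext c)) v (λ m _ eq → ¬on (subst (λ x → OnCycle x c) (sym eq) (pos-on m))))
                       (sym (cyclePerm-off ¬on))
  ... | yes on with on⇒pos on
  ... | m , s≤s m≤ , refl with ℕ.m≤n⇒m<n∨m≡n m≤
  ... | inj₁ m<  = trans (path-step last m ℕ.≤-refl m<) (sym (cyclePerm-pos m))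
    where last = suc (ext c)
  ... | inj₂ refl = begin
    composeTranspositions (path last) (pos last) ≡⟨ path-end last ⟩
    pos 0                                        ≡⟨ pos-period 0 ⟨
    pos (len c + 0)                              ≡⟨ cong pos (ℕ.+-identityʳ (len c)) ⟩
    pos (len c)                                  ≡⟨ cyclePerm-pos last ⟨
    cyclePerm c (pos last)                       ∎
    where
    open ≡-Reasoning
    last = suc (ext c)

-- Words in the shifts

module Configuration {n k : ℕ} {G : Graph n} (𝒞 : Fin k → Cycle G) where


  Word : Set
  Word = List (Shift 𝒞)

  infixr 20 _·_

  _·_ : Word → Fin n → Fin n
  w · v = evalWord 𝒞 w v

  flip : Shift 𝒞 → Shift 𝒞
  flip (i , b) = i , not b

  shift-flip : ∀ s v → shift 𝒞 s (shift 𝒞 (flip s) v) ≡ v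
  shift-flip (i , true)  = cyclePerm-cyclePermInv (𝒞 i)
  shift-flip (i , false) = cyclePermInv-cyclePerm (𝒞 i)

  flip-shift : ∀ s v → shift 𝒞 (flip s) (shift 𝒞 s v) ≡ v
  flip-shift (i , true)  = cyclePermInv-cyclePerm (𝒞 i)
  flip-shift (i , false) = cyclePerm-cyclePermInv (𝒞 i)

  infix 25 _⁻¹

  _⁻¹ : Word → Word
  []      ⁻¹ = []
  (s ∷ w) ⁻¹ = w ⁻¹ ++ [ flip s ]

  ·-++ : ∀ g h v → (g ++ h) · v ≡ g · h · v
  ·-++ []      h v = refl
  ·-++ (s ∷ g) h v = cong (shift 𝒞 s) (·-++ g h v)

  inverseʳ : ∀ g v → g · g ⁻¹ · v ≡ v
  inverseʳ []      v = refl
  inverseʳ (s ∷ g) v = trans (cong (λ x → shift 𝒞 s (g · x)) (·-++ (g ⁻¹) _ v))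
    (trans (cong (shift 𝒞 s) (inverseʳ g _)) (shift-flip s v))

  inverseˡ : ∀ g v → g ⁻¹ · g · v ≡ v
  inverseˡ []      v = refl
  inverseˡ (s ∷ g) v = trans (·-++ (g ⁻¹) _ _)
    (trans (cong (g ⁻¹ ·_) (flip-shift s _)) (inverseˡ g v))

  ·-injective : ∀ g {u v} → g · u ≡ g · v → u ≡ v
  ·-injective g {u} {v} eq = trans (sym (inverseˡ g u)) (trans (cong (g ⁻¹ ·_) eq) (inverseˡ g v))

  solveˡ : ∀ g {u v} → g · u ≡ v → g ⁻¹ · v ≡ u
  solveˡ g {u} refl = inverseˡ g u

  solveʳ : ∀ g {u v} → g ⁻¹ · v ≡ u → g · u ≡ v
  solveʳ g {v = v} refl = inverseʳ g v

  length-⁻¹ : ∀ g → length (g ⁻¹) ≡ length g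
  length-⁻¹ []      = refl
  length-⁻¹ (s ∷ g) = trans (length-++ (g ⁻¹)) (trans (ℕ.+-comm _ 1) (cong suc (length-⁻¹ g)))

  _^^_ : Shift 𝒞 → ℕ → Word
  s ^^ m = replicate m s

  ^^-suc : ∀ s m v → (s ^^ suc m) · v ≡ (s ^^ m) · shift 𝒞 s v
  ^^-suc s zero    v = refl
  ^^-suc s (suc m) v = cong (shift 𝒞 s) (^^-suc s m v)

  ^^-flip : ∀ s m v → (flip s ^^ m) · (s ^^ m) · v ≡ v
  ^^-flip s zero    v = refl
  ^^-flip s (suc m) v = trans (^^-suc (flip s) m _)
    (trans (cong ((flip s ^^ m) ·_) (flip-shift s _)) (^^-flip s m v))

  conj : Word → Word → Word
  conj g h = g ++ h ++ g ⁻¹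

  conj-· : ∀ g h v → conj g h · v ≡ g · h · g ⁻¹ · v
  conj-· g h v = trans (·-++ g _ v) (cong (g ·_) (·-++ h _ v))

  comm : Word → Word → Word
  comm g h = conj g h ++ h ⁻¹

  comm-· : ∀ g h v → comm g h · v ≡ g · h · g ⁻¹ · h ⁻¹ · v
  comm-· g h v = trans (·-++ (conj g h) _ v) (conj-· g h _)

  length-conj : ∀ g h → length (conj g h) ≡ length g + (length h + length g)
  length-conj g h = trans (length-++ g)
    (cong (length g +_) (trans (length-++ h) (cong (length h +_) (length-⁻¹ g))))

  length-comm : ∀ g h → length (comm g h) ≡ length g + (length h + length g) + length h
  length-comm g h = trans (length-++ (conj g h)) (cong₂ _+_ (length-conj g h) (length-⁻¹ h))

  Is3 : Word → Fin n → Fin n → Fin n → Set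
  Is3 w = IsThreeCycle (w ·_)

  -- Powers of a single shift

  module _ {i : Fin k} where

    ^^-pos : ∀ m p → ((i , true) ^^ m) · pos (𝒞 i) p ≡ pos (𝒞 i) (m + p)
    ^^-pos zero    p = refl
    ^^-pos (suc m) p = trans (cong (cyclePerm (𝒞 i)) (^^-pos m p)) (cyclePerm-pos (𝒞 i) (m + p))

    shift-off : ∀ b {v} → ¬ OnCycle v (𝒞 i) → shift 𝒞 (i , b) v ≡ v
    shift-off true  = cyclePerm-off (𝒞 i)
    shift-off false = cyclePermInv-off (𝒞 i)

    cyclePerm-on : ∀ {v} → OnCycle v (𝒞 i) → OnCycle (cyclePerm (𝒞 i) v) (𝒞 i)
    cyclePerm-on (j , refl) = next j , sym (cyclePerm-vs (𝒞 i) j)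

    shift-on : ∀ b {v} → OnCycle v (𝒞 i) → OnCycle (shift 𝒞 (i , b) v) (𝒞 i)
    shift-on true  on         = cyclePerm-on on
    shift-on false (j , refl) = prev j , sym (cyclePermInv-vs (𝒞 i) j)

    ^^-on : ∀ b m {v} → OnCycle v (𝒞 i) → OnCycle (((i , b) ^^ m) · v) (𝒞 i)
    ^^-on b zero    on = on
    ^^-on b (suc m) on = shift-on b (^^-on b m on)

    aperiodic : ∀ b m {v} → OnCycle v (𝒞 i) → 0 < m → m < len (𝒞 i) → ((i , b) ^^ m) · v ≢ v
    aperiodic true m on 0<m m< eq with on⇒pos (𝒞 i) on
    ... | p , _ , refl = pos-≢ (𝒞 i) m p 0<m m< (trans (sym (^^-pos m p)) eq)
    aperiodic false m {v} on 0<m m< eq =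
      aperiodic true m on 0<m m< (trans (cong (((i , true) ^^ m) ·_) (sym eq)) (^^-flip (i , false) m v))

    shift-moves : ∀ b {v} → OnCycle v (𝒞 i) → shift 𝒞 (i , b) v ≢ v
    shift-moves b on = aperiodic b 1 on (s≤s z≤n) (s≤s (s≤s z≤n))

    opaque
      reach : ∀ b {u v} → OnCycle u (𝒞 i) → OnCycle v (𝒞 i) →
        ∃ λ m → m < len (𝒞 i) × ((i , b) ^^ m) · u ≡ v
      reach true on-u on-v with on⇒pos (𝒞 i) on-u | on⇒pos (𝒞 i) on-v
      ... | p , p< , refl | q , q< , refl with ℕ.≤-total p q
      ... | inj₁ p≤q = q ∸ p , ℕ.≤-<-trans (ℕ.m∸n≤m q p) q<
                     , trans (^^-pos (q ∸ p) p) (cong (pos (𝒞 i)) (ℕ.m∸n+n≡m p≤q))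
      ... | inj₂ q≤p with ℕ.m≤n⇒m<n∨m≡n q≤p
      -- Equal positions are split off: going round as in the next case would take d steps, which is
      -- not below d.
      ... | inj₂ refl = 0 , s≤s z≤n , refl
      ... | inj₁ q<p = d ∸ (p ∸ q) , ℕ.∸-monoʳ-< (ℕ.m<n⇒0<n∸m q<p) (ℕ.≤-trans (ℕ.m∸n≤m p q) (ℕ.<⇒≤ p<))
                     , trans (^^-pos (d ∸ (p ∸ q)) p) (trans (cong (pos (𝒞 i)) wrap) (pos-period (𝒞 i) q))
        where
        d : ℕ
        d = len (𝒞 i)
        wrap : d ∸ (p ∸ q) + p ≡ d + q
        wrap = begin
          d ∸ (p ∸ q) + p               ≡⟨ cong (d ∸ (p ∸ q) +_) (ℕ.m∸n+n≡m q≤p) ⟨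
          d ∸ (p ∸ q) + ((p ∸ q) + q)   ≡⟨ ℕ.+-assoc (d ∸ (p ∸ q)) (p ∸ q) q ⟨
          d ∸ (p ∸ q) + (p ∸ q) + q     ≡⟨ cong (_+ q) (ℕ.m∸n+n≡m (ℕ.≤-trans (ℕ.m∸n≤m p q) (ℕ.<⇒≤ p<))) ⟩
          d + q                         ∎
          where open ≡-Reasoning
      -- Backwards from u to v takes as many steps as forwards from v to u.
      reach false on-u on-v with reach true on-v on-u
      ... | m , m< , eq = m , m< , trans (cong (((i , false) ^^ m) ·_) (sym eq)) (^^-flip (i , true) m _)

    ^^-period : ∀ b {v} → OnCycle v (𝒞 i) → ((i , b) ^^ len (𝒞 i)) · v ≡ v
    ^^-period true on with on⇒pos (𝒞 i) on
    ... | p , _ , refl = trans (^^-pos (len (𝒞 i)) p) (pos-period (𝒞 i) p)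
    ^^-period false {v} on =
      trans (cong (((i , false) ^^ len (𝒞 i)) ·_) (sym (^^-period true on))) (^^-flip (i , true) (len (𝒞 i)) v)

  -- Conjugation by g relabels h. All points moved by h except x are fixed by g, so `conj g h` is h
  -- with x renamed to g·x: it takes h⁻¹·x to g·x and g·x to h·x. Against h⁻¹ everything cancels
  -- except on x, g·x and h·x.
  comm-threeCycle : ∀ g h x → g · x ≢ x → h · x ≢ x → (∀ y → y ≢ x → g · y ≡ y ⊎ h · y ≡ y) →
    Is3 (comm g h) x (g · x) (h · x)
  comm-threeCycle g h x gx≢x hx≢x disjoint = record
    { a≢b = gx≢x ∘ sym
    ; b≢c = λ gx≡hx → hx≢x (·-injective h (subst (λ y → h · y ≡ y) gx≡hx h-fixes-gx))
    ; c≢a = hx≢x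
    ; ab  = trans (comm-· g h x)
              (cong (g ·_) (trans (cong (h ·_) (solveˡ g g-fixes-h⁻¹x)) (inverseʳ h x)))
    ; bc  = trans (comm-· g h _) (trans (cong (λ y → g · h · g ⁻¹ · y) (solveˡ h h-fixes-gx))
              (trans (cong (λ y → g · h · y) (inverseˡ g x)) g-fixes-hx))
    ; ca  = trans (comm-· g h _) (trans (cong (λ y → g · h · g ⁻¹ · y) (inverseˡ h x))
              (trans (cong (g ·_) h-fixes-g⁻¹x) (inverseʳ g x)))
    ; fix = fix
    }
    where
    h-fixes : ∀ y → y ≢ x → g · y ≢ y → h · y ≡ y
    h-fixes y y≢x gy≢y with disjoint y y≢x
    ... | inj₁ eq = contradiction eq gy≢y
    ... | inj₂ eq = eq
    g-fixes : ∀ y → y ≢ x → h · y ≢ y → g · y ≡ y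
    g-fixes y y≢x hy≢y with disjoint y y≢x
    ... | inj₁ eq = eq
    ... | inj₂ eq = contradiction eq hy≢y
    h-fixes-gx : h · g · x ≡ g · x
    h-fixes-gx = h-fixes _ gx≢x (gx≢x ∘ ·-injective g)
    g-fixes-hx : g · h · x ≡ h · x
    g-fixes-hx = g-fixes _ hx≢x (hx≢x ∘ ·-injective h)
    g-fixes-h⁻¹x : g · h ⁻¹ · x ≡ h ⁻¹ · x
    g-fixes-h⁻¹x = g-fixes _ (hx≢x ∘ solveʳ h)
      (λ eq → hx≢x (solveʳ h (trans (sym eq) (inverseʳ h x))))
    h-fixes-g⁻¹x : h · g ⁻¹ · x ≡ g ⁻¹ · x
    h-fixes-g⁻¹x = h-fixes _ (gx≢x ∘ solveʳ g)
      (λ eq → gx≢x (solveʳ g (trans (sym eq) (inverseʳ g x))))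
    fix : ∀ y → y ≢ x → y ≢ g · x → y ≢ h · x → comm g h · y ≡ y
    fix y y≢x y≢gx y≢hx = trans (comm-· g h y) (by (h · y ≟ᶠ y))
      where
      h⁻¹y≢x : h ⁻¹ · y ≢ x
      h⁻¹y≢x eq = y≢hx (sym (solveʳ h eq))
      g⁻¹y≢x : g ⁻¹ · y ≢ x
      g⁻¹y≢x eq = y≢gx (sym (solveʳ g eq))
      by : Dec (h · y ≡ y) → g · h · g ⁻¹ · h ⁻¹ · y ≡ y
      by (no hy≢y) = trans (cong (λ z → g · h · z) (solveˡ g (g-fixes _ h⁻¹y≢x
          (λ eq → hy≢y (solveʳ h (trans (sym eq) (inverseʳ h y)))))))
        (trans (cong (g ·_) (inverseʳ h y)) (g-fixes y y≢x hy≢y))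
      by (yes hy≡y) = trans (cong (λ z → g · h · g ⁻¹ · z) (solveˡ h hy≡y))
        (trans (cong (g ·_) h-fixes-g⁻¹y) (inverseʳ g y))
        where
        h-fixes-g⁻¹y : h · g ⁻¹ · y ≡ g ⁻¹ · y
        h-fixes-g⁻¹y with g · y ≟ᶠ y
        ... | yes gy≡y = trans (cong (h ·_) (solveˡ g gy≡y)) (trans hy≡y (sym (solveˡ g gy≡y)))
        ... | no  gy≢y = h-fixes _ g⁻¹y≢x (λ eq → gy≢y (solveʳ g (trans (sym eq) (inverseʳ g y))))

  Is3-rotate : ∀ {w a b c} → Is3 w a b c → Is3 w b c a
  Is3-rotate (threeCycle a≢b b≢c c≢a ab bc ca fix) =
    threeCycle b≢c c≢a a≢b bc ca ab (λ v p q r → fix v r p q)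

  Is3-invert : ∀ {w a b c} → Is3 w a b c → Is3 (w ⁻¹) b a c
  Is3-invert {w} (threeCycle a≢b b≢c c≢a ab bc ca fix) =
    threeCycle (a≢b ∘ sym) (c≢a ∘ sym) (b≢c ∘ sym)
      (solveˡ w ab) (solveˡ w ca) (solveˡ w bc) (λ v p q r → solveˡ w (fix v q p r))

  Is3-conj : ∀ g {w a b c} → Is3 w a b c → Is3 (conj g w) (g · a) (g · b) (g · c)
  Is3-conj g {w} (threeCycle a≢b b≢c c≢a ab bc ca fix) =
    threeCycle (a≢b ∘ ·-injective g) (b≢c ∘ ·-injective g) (c≢a ∘ ·-injective g)
      (carry ab) (carry bc) (carry ca) fix′
    where
    carry : ∀ {u v} → w · u ≡ v → conj g w · g · u ≡ g · v
    carry {u} refl = trans (conj-· g w _) (cong (λ x → g · w · x) (inverseˡ g u))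
    fix′ : ∀ v → v ≢ g · _ → v ≢ g · _ → v ≢ g · _ → conj g w · v ≡ v
    fix′ v p q r = trans (conj-· g w v)
      (trans (cong (g ·_) (fix _ (p ∘ back) (q ∘ back) (r ∘ back))) (inverseʳ g v))
      where
      back : ∀ {u} → g ⁻¹ · v ≡ u → v ≡ g · u
      back eq = sym (solveʳ g eq)

  -- Blocks of points joined by 3-cycles

  Tri : Fin n → Fin n → Fin n → Set
  Tri a b c = ∃ λ w → Is3 w a b c

  rotate : ∀ {a b c} → Tri a b c → Tri b c a
  rotate (w , t) = w , Is3-rotate {w} t

  invert : ∀ {a b c} → Tri a b c → Tri b a c
  invert (w , t) = w ⁻¹ , Is3-invert {w} t

  conjugate : ∀ g {a b c a′ b′ c′} → g · a ≡ a′ → g · b ≡ b′ → g · c ≡ c′ → Tri a b c → Tri a′ b′ c′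
  conjugate g refl refl refl (w , t) = conj g w , Is3-conj g {w} t

  infix 4 _~_

  data _~_ (a b : Fin n) : Set where
    same : a ≡ b → a ~ b
    tri  : ∀ c → Tri a b c → a ~ b

  ~-sym : ∀ {a b} → a ~ b → b ~ a
  ~-sym (same eq) = same (sym eq)
  ~-sym (tri c t) = tri c (invert t)

  -- Conjugating (a b x) by g = (b c y) moves b to c and leaves a alone, provided that a is neither
  -- c nor y. If a = y, then (b c y) itself already joins a and c.
  ~-trans : ∀ {a b c} → a ~ b → b ~ c → a ~ c
  ~-trans (same refl) q = q
  ~-trans p (same refl) = p
  ~-trans {a} {b} {c} (tri x t) (tri y u@(g , threeCycle b≢c c≢y _ gb≡c _ _ fix)) with a ≟ᶠ c | a ≟ᶠ y
  ... | yes a≡c | _        = same a≡c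
  ... | no _    | yes refl = tri b (invert (rotate u))
  ... | no a≢c  | no a≢y   =
    tri (g · x) (conjugate g (fix a (t .proj₂ .IsThreeCycle.a≢b) a≢c a≢y) gb≡c refl t)

  ~-act : ∀ g {a b} → a ~ b → g · a ~ g · b
  ~-act g (same refl) = same refl
  ~-act g (tri c t)   = tri (g · c) (conjugate g refl refl refl t)

  -- The 3-cycle (a b x) is turned into (a b c) by conjugating with a 3-cycle (x c y);
  -- when y ∈ {a, b} the inverses have to be used.
  allTri : (∀ a b → a ~ b) → ∀ a b c → a ≢ b → b ≢ c → c ≢ a → Tri a b c
  allTri all a b c a≢b b≢c c≢a with all a b
  ... | same eq = contradiction eq a≢b
  ... | tri x t@(w , threeCycle _ b≢x x≢a _ _ _ _) with all x c
  ... | same refl = t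
  ... | tri y (h , threeCycle x≢c c≢y y≢x hx hc hy fix) with y ≟ᶠ a | y ≟ᶠ b
  ... | yes refl | _ =
    rotate (rotate (invert (conjugate (h ⁻¹)
      (solveˡ h hc) (solveˡ h (fix b b≢x b≢c (a≢b ∘ sym))) (solveˡ h hy) t)))
  ... | no _ | yes refl =
    rotate (invert (conjugate (h ⁻¹)
      (solveˡ h (fix a (x≢a ∘ sym) (c≢a ∘ sym) a≢b)) (solveˡ h hc) (solveˡ h hy) t))
  ... | no y≢a | no y≢b =
    conjugate h (fix a (x≢a ∘ sym) (c≢a ∘ sym) (y≢a ∘ sym)) (fix b b≢x b≢c (y≢b ∘ sym)) hx t

  Connected : Fin k → Set
  Connected i = ∀ {u v} → OnCycle u (𝒞 i) → OnCycle v (𝒞 i) → u ~ v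

  -- The relation is invariant under the shift, so a single related step is repeated all around the
  -- cycle.
  connect : ∀ {i u} b → OnCycle u (𝒞 i) → u ~ shift 𝒞 (i , b) u → Connected i
  connect {i} {u} b on-u u~ on-v on-w = ~-trans (~-sym (fromU on-v)) (fromU on-w)
    where
    along : ∀ m → u ~ ((i , b) ^^ m) · u
    along zero    = same refl
    along (suc m) = ~-trans u~ (~-act [ i , b ] (along m))
    fromU : ∀ {v} → OnCycle v (𝒞 i) → u ~ v
    fromU on with reach b on-u on
    ... | m , _ , eq = subst (u ~_) eq (along m)

  consecutive⇒connected : ∀ {i u v} → Consecutive (𝒞 i) u v → u ~ v → Connected i
  consecutive⇒connected {i} (j , inj₁ (refl , refl)) u~v =
    connect true (j , refl) (subst (_ ~_) (sym (cyclePerm-vs (𝒞 i) j)) u~v)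
  consecutive⇒connected {i} (j , inj₂ (refl , refl)) u~v =
    connect true (j , refl) (subst (_ ~_) (sym (cyclePerm-vs (𝒞 i) j)) (~-sym u~v))

  -- With one common vertex v, its successor t on the first cycle lies off the second. The second
  -- shift E fixes t and turns t ~ v into t ~ E·v, whence v ~ E·v. A common edge is itself a related
  -- step of the second cycle.
  propagate : ∀ {i j} → Connected i → ProperlyInterconnected (𝒞 i) (𝒞 j) → Connected j
  propagate {i} {j} con (inj₁ (v , v∈i , v∈j , only)) =
    connect true v∈j (~-trans v~t (subst (_~ cyclePerm (𝒞 j) v) (shift-off true t∉j) (~-act [ j , true ] (~-sym v~t))))
    where
    t = cyclePerm (𝒞 i) v
    v~t : v ~ t
    v~t = con v∈i (cyclePerm-on v∈i)
    t∉j : ¬ OnCycle t (𝒞 j)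
    t∉j on = shift-moves true v∈i (only t (cyclePerm-on v∈i) on)
  propagate con (inj₂ (u , v , u≢v , u∈i , u∈j , v∈i , v∈j , only , consᵢ , consⱼ)) =
    consecutive⇒connected consⱼ (con u∈i v∈i)

  shared : ∀ {i j} → ProperlyInterconnected (𝒞 i) (𝒞 j) → ∃ λ v → OnCycle v (𝒞 i) × OnCycle v (𝒞 j)
  shared (inj₁ (v , v∈i , v∈j , _))                   = v , v∈i , v∈j
  shared (inj₂ (u , _ , _ , u∈i , u∈j , _))           = u , u∈i , u∈j

  path-connected : ∀ {S i j u v} → PathIn 𝒞 S i j → Connected i → OnCycle u (𝒞 i) → OnCycle v (𝒞 j) → u ~ v
  path-connected here             con on-u on-v = con on-u on-v
  path-connected (step pi _ rest) con on-u on-v with shared pi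
  ... | w , w∈i , w∈j = ~-trans (con on-u w∈i) (path-connected rest (propagate con pi) w∈j on-v)

  -- A first 3-cycle from neighbouring cycles

  record Seed (i : Fin k) : Set where
    constructor seed
    field
      {a b c}   : Fin n
      word      : Word
      is3       : Is3 word a b c
      -- The longest word comes from `third`; the one in `long` has 18 letters.
      short     : length word ≤ 20
      connected : Connected i

  -- A common edge, with the directions `bᵢ` and `bⱼ` chosen so that both cycles run from u to v.
  -- This spares a distinction of orientations in every construction below.
  record Link (i j : Fin k) (u v : Fin n) : Set where
    field
      u≢v      : u ≢ v
      u∈i      : OnCycle u (𝒞 i)
      u∈j      : OnCycle u (𝒞 j)
      v∈i      : OnCycle v (𝒞 i)
      v∈j      : OnCycle v (𝒞 j)
      only     : ∀ w → OnCycle w (𝒞 i) → OnCycle w (𝒞 j) → w ≡ u ⊎ w ≡ v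
      bᵢ bⱼ    : Bool
      turnᵢ    : shift 𝒞 (i , bᵢ) u ≡ v
      turnⱼ    : shift 𝒞 (j , bⱼ) u ≡ v

    apart : ∀ {y} b b′ → y ≢ u → y ≢ v → shift 𝒞 (i , b) y ≡ y ⊎ shift 𝒞 (j , b′) y ≡ y
    apart {y} b b′ y≢u y≢v with onCycle? (𝒞 i) y
    ... | no y∉i = inj₁ (shift-off b y∉i)
    ... | yes y∈i = inj₂ (shift-off b′ y∉j)
      where
      y∉j : ¬ OnCycle y (𝒞 j)
      y∉j y∈j with only y y∈i y∈j
      ... | inj₁ eq = y≢u eq
      ... | inj₂ eq = y≢v eq

  Link-swap : ∀ {i j u v} → Link i j u v → Link j i u v
  Link-swap l = record
    { u≢v = u≢v ; u∈i = u∈j ; u∈j = u∈i ; v∈i = v∈j ; v∈j = v∈i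
    ; only = λ w p q → only w q p ; bᵢ = bⱼ ; bⱼ = bᵢ ; turnᵢ = turnⱼ ; turnⱼ = turnᵢ }
    where open Link l

  Link-reverse : ∀ {i j u v} → Link i j u v → Link i j v u
  Link-reverse {i} {j} {u} l = record
    { u≢v = u≢v ∘ sym ; u∈i = v∈i ; u∈j = v∈j ; v∈i = u∈i ; v∈j = u∈j
    ; only = λ w p q → swap (only w p q) ; bᵢ = not bᵢ ; bⱼ = not bⱼ
    ; turnᵢ = trans (cong (shift 𝒞 (i , not bᵢ)) (sym turnᵢ)) (flip-shift (i , bᵢ) u)
    ; turnⱼ = trans (cong (shift 𝒞 (j , not bⱼ)) (sym turnⱼ)) (flip-shift (j , bⱼ) u) }
    where open Link l

  orient : ∀ {i u v} → Consecutive (𝒞 i) u v → ∃ λ b → shift 𝒞 (i , b) u ≡ v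
  orient {i} (p , inj₁ (refl , refl)) = true , cyclePerm-vs (𝒞 i) p
  orient {i} (p , inj₂ (refl , refl)) = false ,
    trans (cong (cyclePermInv (𝒞 i)) (sym (cyclePerm-vs (𝒞 i) p))) (cyclePermInv-cyclePerm (𝒞 i) _)

  touching : ∀ {i j v} → OnCycle v (𝒞 i) → OnCycle v (𝒞 j) →
    (∀ w → OnCycle w (𝒞 i) → OnCycle w (𝒞 j) → w ≡ v) → Seed i
  touching {i} {j} {v} v∈i v∈j only = seed (comm D E) comm3 (ℕ.≤ᵇ⇒≤ _ _ _)
    (connect true v∈i (tri _ (comm D E , comm3)))
    where
    D = [ i , true ]
    E = [ j , true ]
    disjoint : ∀ y → y ≢ v → D · y ≡ y ⊎ E · y ≡ y
    disjoint y y≢v with onCycle? (𝒞 i) y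
    ... | no y∉i  = inj₁ (shift-off true y∉i)
    ... | yes y∈i = inj₂ (shift-off true (λ y∈j → y≢v (only y y∈i y∈j)))
    comm3 : Is3 (comm D E) v (D · v) (E · v)
    comm3 = comm-threeCycle D E v (shift-moves true v∈i) (shift-moves true v∈j) disjoint

  digon-within : ∀ {i j u v} → Link i j u v → len (𝒞 i) ≡ 2 → ∀ {y} → OnCycle y (𝒞 i) → y ≡ u ⊎ y ≡ v
  digon-within l len≡2 y∈i with reach (Link.bᵢ l) (Link.u∈i l) y∈i
  ... | 0 , _ , eq = inj₁ (sym eq)
  ... | 1 , _ , eq = inj₂ (trans (sym eq) (Link.turnᵢ l))
  ... | suc (suc m) , m< , _ = contradiction (subst (2 + m <_) len≡2 m<) λ { (s≤s (s≤s ())) }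

  -- Write D = (u v) and E = (u v e₁ ...). The conjugate E D E⁻¹ is (v e₁), and it meets D only in v
  -- because e₁ differs from u on a cycle of length at least 3.
  digon : ∀ {i j u v} → Link i j u v → len (𝒞 i) ≡ 2 → 2 < len (𝒞 j) → Seed i
  digon {i} {j} {u} {v} l len≡2 2<len = seed (comm D g) comm3 (ℕ.≤ᵇ⇒≤ _ _ _)
    (connect bᵢ v∈i (tri _ (comm D g , comm3)))
    where
    open Link l
    D = [ i , bᵢ ]
    E = [ j , bⱼ ]
    g = conj E D
    Ev≢u : E · v ≢ u
    Ev≢u eq = aperiodic bⱼ 2 u∈j (s≤s z≤n) 2<len (trans (cong (E ·_) turnⱼ) eq)
    E⁻¹u∉i : ¬ OnCycle (E ⁻¹ · u) (𝒞 i)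
    E⁻¹u∉i on with digon-within l len≡2 on
    ... | inj₁ eq = shift-moves bⱼ u∈j (solveʳ E eq)
    ... | inj₂ eq = Ev≢u (solveʳ E eq)
    gu≡u : g · u ≡ u
    gu≡u = trans (conj-· E D u) (trans (cong (E ·_) (shift-off bᵢ E⁻¹u∉i)) (inverseʳ E u))
    gv≡Ev : g · v ≡ E · v
    gv≡Ev = trans (conj-· E D v) (cong (E ·_) (trans (cong (D ·_) (solveˡ E turnⱼ)) turnᵢ))
    disjoint : ∀ y → y ≢ v → D · y ≡ y ⊎ g · y ≡ y
    disjoint y y≢v with y ≟ᶠ u
    ... | yes refl = inj₂ gu≡u
    ... | no y≢u = inj₁ (shift-off bᵢ (λ on → [ y≢u , y≢v ]′ (digon-within l len≡2 on)))
    comm3 : Is3 (comm D g) v (D · v) (g · v)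
    comm3 = comm-threeCycle D g v (shift-moves bᵢ v∈i)
      (λ eq → shift-moves bⱼ v∈j (trans (sym gv≡Ev) eq)) disjoint

  triangle : ∀ {i u} (b : Bool) → OnCycle u (𝒞 i) → len (𝒞 i) ≡ 3 → Seed i
  triangle {i} {u} b u∈i len≡3 = seed D is3 (s≤s z≤n) (connect b u∈i (tri _ (D , is3)))
    where
    D = [ i , b ]
    3≤len : 3 ≤ len (𝒞 i)
    3≤len = ℕ.≤-reflexive (sym len≡3)
    D³ : D · D · D · u ≡ u
    D³ = subst (λ d → ((i , b) ^^ d) · u ≡ u) len≡3 (^^-period b u∈i)
    fix : ∀ y → y ≢ u → y ≢ D · u → y ≢ D · D · u → D · y ≡ y
    fix y p q r = shift-off b off
      where
      off : ¬ OnCycle y (𝒞 i)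
      off y∈i with reach b u∈i y∈i
      ... | 0 , _ , eq = p (sym eq)
      ... | 1 , _ , eq = q (sym eq)
      ... | 2 , _ , eq = r (sym eq)
      ... | suc (suc (suc m)) , m< , _ =
        contradiction (subst (suc (suc (suc m)) <_) len≡3 m<) λ { (s≤s (s≤s (s≤s ()))) }
    is3 : Is3 D u (D · u) (D · D · u)
    is3 = record
      { a≢b = shift-moves b u∈i ∘ sym
      ; b≢c = shift-moves b (shift-on b u∈i) ∘ sym
      ; c≢a = aperiodic b 2 u∈i (s≤s z≤n) 3≤len
      ; ab = refl ; bc = refl ; ca = D³ ; fix = fix }

  -- For such y the points y, g⁻¹·y and h⁻¹·y all avoid u and v, so each of them is fixed by g or by
  -- h, and the commutator cancels as it does for disjoint supports.
  comm-fix : ∀ g h {u v} → (∀ y → y ≢ u → y ≢ v → g · y ≡ y ⊎ h · y ≡ y) →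
    ∀ y → y ≢ u → y ≢ v → y ≢ g · u → y ≢ g · v → y ≢ h · u → y ≢ h · v → comm g h · y ≡ y
  comm-fix g h {u} {v} apart y y≢u y≢v y≢gu y≢gv y≢hu y≢hv = trans (comm-· g h y) main
    where
    away : ∀ w {x} → y ≢ w · x → w ⁻¹ · y ≢ x
    away w y≢wx eq = y≢wx (sym (solveʳ w eq))
    main : g · h · g ⁻¹ · h ⁻¹ · y ≡ y
    main with apart (h ⁻¹ · y) (away h y≢hu) (away h y≢hv)
    main | inj₁ gz≡z = trans (cong (λ z → g · h · z) (solveˡ g gz≡z))
      (trans (cong (g ·_) (inverseʳ h y)) gy≡y)
      where
      gy≡y : g · y ≡ y
      gy≡y with apart y y≢u y≢v
      ... | inj₁ eq = eq
      ... | inj₂ hy≡y = subst (λ z → g · z ≡ z) (solveˡ h hy≡y) gz≡z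
    main | inj₂ hz≡z = trans (cong (λ z → g · h · g ⁻¹ · z) h⁻¹y≡y) inner
      where
      h⁻¹y≡y : h ⁻¹ · y ≡ y
      h⁻¹y≡y = trans (sym hz≡z) (inverseʳ h y)
      inner : g · h · g ⁻¹ · y ≡ y
      inner with apart (g ⁻¹ · y) (away g y≢gu) (away g y≢gv)
      ... | inj₂ eq = trans (cong (g ·_) eq) (inverseʳ g y)
      ... | inj₁ eq = trans (cong (λ z → g · h · z) g⁻¹y≡y)
              (trans (cong (g ·_) (solveʳ h h⁻¹y≡y)) (solveʳ g g⁻¹y≡y))
        where
        g⁻¹y≡y : g ⁻¹ · y ≡ y
        g⁻¹y≡y = trans (sym eq) (inverseʳ g y)

  -- Write D = (u v d …) and E = (u v e₁ e₂ e₃ …). The commutator [D, E] = (u v)(d e₁) becomes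
  -- (e₁ e₂)(d e₃) after conjugation with E², and this meets D only in d.
  long : ∀ {i j u v} → Link i j u v → 2 < len (𝒞 i) → 4 < len (𝒞 j) → Seed i
  long {i} {j} {u} {v} l 2<len 4<len = seed (comm g D) comm3 (ℕ.≤ᵇ⇒≤ _ _ _)
    (connect bᵢ d∈i (~-sym (tri _ (rotate (rotate (comm g D , comm3))))))
    where
    open Link l
    D = [ i , bᵢ ]
    E = [ j , bⱼ ]
    E² = (j , bⱼ) ^^ 2
    c = comm D E
    g = conj E² c
    d = D · v
    e₁ = E · v
    e₂ = E · e₁
    e₃ = E · e₂
    E²u≡e₁ : E² · u ≡ e₁
    E²u≡e₁ = cong (E ·_) turnⱼ
    d∈i : OnCycle d (𝒞 i)
    d∈i = shift-on bᵢ v∈i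
    d≢u : d ≢ u
    d≢u eq = aperiodic bᵢ 2 u∈i (s≤s z≤n) 2<len (trans (cong (D ·_) turnᵢ) eq)
    d≢v : d ≢ v
    d≢v = shift-moves bᵢ v∈i
    d∉j : ¬ OnCycle d (𝒞 j)
    d∉j on = [ d≢u , d≢v ]′ (only d d∈i on)
    Ed≡d : E · d ≡ d
    Ed≡d = shift-off bⱼ d∉j
    E²d≡d : E² · d ≡ d
    E²d≡d = trans (cong (E ·_) Ed≡d) Ed≡d
    -- Only u and E·u = v lie on both cycles. As 𝒞 j has at least five vertices, E²u, E³u and E⁴u,
    -- which are e₁, e₂ and e₃, are different from both.
    off-i : ∀ m → 1 < m → m < 5 → ¬ OnCycle (((j , bⱼ) ^^ m) · u) (𝒞 i)
    off-i (suc m) (s≤s 0<m) (s≤s m<4) on with only _ on (^^-on bⱼ (suc m) u∈j)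
    ... | inj₁ eq = aperiodic bⱼ (suc m) u∈j (s≤s z≤n) (ℕ.≤-<-trans m<4 4<len) eq
    ... | inj₂ eq = aperiodic bⱼ m u∈j 0<m (ℕ.≤-<-trans (ℕ.<⇒≤ m<4) 4<len)
                      (·-injective E (trans eq (sym turnⱼ)))
    power : ∀ m → ((j , bⱼ) ^^ suc m) · u ≡ ((j , bⱼ) ^^ m) · v
    power m = trans (^^-suc (j , bⱼ) m u) (cong (((j , bⱼ) ^^ m) ·_) turnⱼ)
    D-fixes : ∀ m → 0 < m → m < 4 → D · ((j , bⱼ) ^^ m) · v ≡ ((j , bⱼ) ^^ m) · v
    D-fixes m 0<m m<4 = shift-off bᵢ (subst (λ x → ¬ OnCycle x (𝒞 i)) (power m) (off-i (suc m) (s≤s 0<m) (s≤s m<4)))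
    De₁≡e₁ : D · e₁ ≡ e₁
    De₁≡e₁ = D-fixes 1 (ℕ.≤ᵇ⇒≤ _ _ _) (ℕ.≤ᵇ⇒≤ _ _ _)
    De₂≡e₂ : D · e₂ ≡ e₂
    De₂≡e₂ = D-fixes 2 (ℕ.≤ᵇ⇒≤ _ _ _) (ℕ.≤ᵇ⇒≤ _ _ _)
    De₃≡e₃ : D · e₃ ≡ e₃
    De₃≡e₃ = D-fixes 3 (ℕ.≤ᵇ⇒≤ _ _ _) (ℕ.≤ᵇ⇒≤ _ _ _)
    cd≡e₁ : c · d ≡ e₁
    cd≡e₁ = trans (comm-· D E d) (trans (cong (λ z → D · E · D ⁻¹ · z) (solveˡ E Ed≡d))
      (trans (cong (λ z → D · E · z) (inverseˡ D v)) De₁≡e₁))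
    gd≡e₃ : g · d ≡ e₃
    gd≡e₃ = trans (conj-· E² c d) (cong (E² ·_) (trans (cong (c ·_) (solveˡ E² E²d≡d)) cd≡e₁))
    disjoint : ∀ y → y ≢ d → g · y ≡ y ⊎ D · y ≡ y
    disjoint y y≢d with y ≟ᶠ e₁ | y ≟ᶠ e₂ | y ≟ᶠ e₃
    ... | yes refl | _ | _ = inj₂ De₁≡e₁
    ... | no _ | yes refl | _ = inj₂ De₂≡e₂
    ... | no _ | no _ | yes refl = inj₂ De₃≡e₃
    ... | no y≢e₁ | no y≢e₂ | no y≢e₃ = inj₁ (trans (conj-· E² c y)
        -- The point z = E⁻²y has to avoid u, v, D·u = v, d, E·u = v and e₁; E² takes these to e₁,
        -- e₂, e₂, d, e₂ and e₃.
        (trans (cong (E² ·_) (comm-fix D E (λ z → apart bᵢ bⱼ) (E² ⁻¹ · y)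
            z≢u z≢v (z≢v ∘ (λ eq → trans eq turnᵢ)) z≢d (z≢v ∘ (λ eq → trans eq turnⱼ)) (avoid y≢e₃)))
          (inverseʳ E² y)))
      where
      avoid : ∀ {x} → y ≢ E² · x → E² ⁻¹ · y ≢ x
      avoid y≢ eq = y≢ (sym (solveʳ E² eq))
      z≢u : E² ⁻¹ · y ≢ u
      z≢u = avoid (λ eq → y≢e₁ (trans eq E²u≡e₁))
      z≢v : E² ⁻¹ · y ≢ v
      z≢v = avoid y≢e₂
      z≢d : E² ⁻¹ · y ≢ d
      z≢d = avoid (λ eq → y≢d (trans eq E²d≡d))
    comm3 : Is3 (comm g D) d (g · d) (D · d)
    comm3 = comm-threeCycle g D d
      (λ eq → shift-moves bᵢ d∈i (trans (cong (D ·_) (trans (sym eq) gd≡e₃))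
         (trans De₃≡e₃ (trans (sym gd≡e₃) eq))))
      (shift-moves bᵢ d∈i) disjoint

  -- With q = Eʲu and g = EʲD, the conjugate gEg⁻¹ moves exactly D·v and the points of E other than q.
  third : ∀ {i j l u v p q} (ij : Link i j u v) → Link j l p q → 2 < len (𝒞 i) →
    ∀ m → m < 4 → ((j , true) ^^ m) · u ≡ q → ¬ OnCycle (shift 𝒞 (i , Link.bᵢ ij) v) (𝒞 l) → Seed l
  third {i} {j} {l} {u} {v} {p} {q} ij jl 2<len m m<4 Eᵐu≡q d∉l = seed (comm h F) comm3 short
    (connect true p∈l (~-sym (tri _ (rotate (rotate (comm h F , comm3))))))
    where
    open Link ij
    open Link jl using () renaming (u≢v to p≢q; u∈i to p∈j; v∈i to q∈j; u∈j to p∈l; only to only-jl)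
    D = [ i , bᵢ ]
    E = [ j , true ]
    F = [ l , true ]
    Eᵐ = (j , true) ^^ m
    g = Eᵐ ++ D
    h = conj g E
    d = D · v
    d≢u : d ≢ u
    d≢u eq = aperiodic bᵢ 2 u∈i (s≤s z≤n) 2<len (trans (cong (D ·_) turnᵢ) eq)
    d∉j : ¬ OnCycle d (𝒞 j)
    d∉j on = [ d≢u , shift-moves bᵢ v∈i ]′ (only d (shift-on bᵢ v∈i) on)
    Eᵐ-fixes : ∀ m {x} → ¬ OnCycle x (𝒞 j) → ((j , true) ^^ m) · x ≡ x
    Eᵐ-fixes zero    x∉j = refl
    Eᵐ-fixes (suc m) x∉j = trans (cong (E ·_) (Eᵐ-fixes m x∉j)) (shift-off true x∉j)
    -- g takes u to Eᵐv, v to d, and any other y on 𝒞 j to Eᵐy. The value q = Eᵐu is missed and d is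
    -- off 𝒞 l, so p is the only image that can lie on 𝒞 l.
    image : ∀ x → OnCycle x (𝒞 j) → OnCycle (g · x) (𝒞 l) → g · x ≡ p
    image x x∈j gx∈l = by (x ≟ᶠ u) (x ≟ᶠ v)
      where
      rest : ∀ {y} → OnCycle y (𝒞 j) → y ≢ u → Eᵐ · y ≡ g · x → g · x ≡ p
      rest {y} y∈j y≢u eq with only-jl (g · x) (subst (λ z → OnCycle z (𝒞 j)) eq (^^-on true m y∈j)) gx∈l
      ... | inj₁ gx≡p = gx≡p
      ... | inj₂ gx≡q = contradiction (·-injective Eᵐ (trans eq (trans gx≡q (sym Eᵐu≡q)))) y≢u
      by : Dec (x ≡ u) → Dec (x ≡ v) → g · x ≡ p
      by (yes refl) _ = rest v∈j (u≢v ∘ sym) (sym (trans (·-++ Eᵐ D u) (cong (Eᵐ ·_) turnᵢ)))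
      by (no _) (yes refl) = contradiction
        (subst (λ z → OnCycle z (𝒞 l)) (trans (·-++ Eᵐ D v) (Eᵐ-fixes m d∉j)) gx∈l) d∉l
      by (no x≢u) (no x≢v) = rest x∈j x≢u (sym (trans (·-++ Eᵐ D x) (cong (Eᵐ ·_) (shift-off bᵢ x∉i))))
        where
        x∉i : ¬ OnCycle x (𝒞 i)
        x∉i x∈i = [ x≢u , x≢v ]′ (only x x∈i x∈j)
    -- The candidate is E⁻ᵐp. If this is v, then D would move it away, and u replaces it since D·u =
    -- v.
    preimage : ∃ λ x → OnCycle x (𝒞 j) × g · x ≡ p
    preimage = by (y ≟ᶠ v)
      where
      y = ((j , false) ^^ m) · p
      y∈j : OnCycle y (𝒞 j)
      y∈j = ^^-on false m p∈j
      Eᵐy≡p : Eᵐ · y ≡ p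
      Eᵐy≡p = ^^-flip (j , false) m p
      y≢u : y ≢ u
      y≢u eq = p≢q (trans (sym Eᵐy≡p) (trans (cong (Eᵐ ·_) eq) Eᵐu≡q))
      by : Dec (y ≡ v) → ∃ λ x → OnCycle x (𝒞 j) × g · x ≡ p
      by (yes y≡v) = u , u∈j
        , trans (·-++ Eᵐ D u) (trans (cong (Eᵐ ·_) (trans turnᵢ (sym y≡v))) Eᵐy≡p)
      by (no y≢v) = y , y∈j
        , trans (·-++ Eᵐ D y) (trans (cong (Eᵐ ·_) (shift-off bᵢ y∉i)) Eᵐy≡p)
        where
        y∉i : ¬ OnCycle y (𝒞 i)
        y∉i y∈i = [ y≢u , y≢v ]′ (only y y∈i y∈j)
    h-moves : h · p ≢ p
    h-moves eq with preimage
    ... | x , x∈j , gx≡p = shift-moves true x∈j (trans (cong (E ·_) (sym (solveˡ g gx≡p)))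
            (·-injective g (trans (sym (conj-· g E p)) (trans eq (sym gx≡p)))))
    disjoint : ∀ y → y ≢ p → h · y ≡ y ⊎ F · y ≡ y
    disjoint y y≢p with onCycle? (𝒞 l) y | onCycle? (𝒞 j) (g ⁻¹ · y)
    ... | no y∉l | _ = inj₂ (shift-off true y∉l)
    ... | yes _ | no z∉j = inj₁ (trans (conj-· g E y)
            (trans (cong (g ·_) (shift-off true z∉j)) (inverseʳ g y)))
    ... | yes y∈l | yes z∈j = contradiction (trans (sym (inverseʳ g y))
            (image _ z∈j (subst (λ z → OnCycle z (𝒞 l)) (sym (inverseʳ g y)) y∈l))) y≢p
    comm3 : Is3 (comm h F) p (h · p) (F · p)
    comm3 = comm-threeCycle h F p h-moves (shift-moves true p∈l) disjoint
    g≤4 : length g ≤ 4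
    g≤4 = begin
      length g      ≡⟨ length-++ Eᵐ ⟩
      length Eᵐ + 1 ≡⟨ cong (_+ 1) (length-replicate m) ⟩
      m + 1         ≡⟨ ℕ.+-comm m 1 ⟩
      suc m         ≤⟨ m<4 ⟩
      4             ∎
      where open ℕ.≤-Reasoning
    h≤9 : length h ≤ 9
    h≤9 = ℕ.≤-trans (ℕ.≤-reflexive (length-conj g E)) (ℕ.+-mono-≤ g≤4 (s≤s g≤4))
    -- With m ≤ 3 the lengths are 4 for g, 4 + 1 + 4 for h, and 9 + 1 + 9 + 1 for the commutator.
    short : length (comm h F) ≤ 20
    short = ℕ.≤-trans (ℕ.≤-reflexive (length-comm h F))
      (ℕ.+-monoˡ-≤ 1 (ℕ.+-mono-≤ h≤9 (s≤s h≤9)))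

  data Pair (i j : Fin k) : Set where
    seedˡ  : Seed i → Pair i j
    seedʳ  : Seed j → Pair i j
    digons : ∀ {u v} → Link i j u v → len (𝒞 i) ≡ 2 → len (𝒞 j) ≡ 2 → Pair i j
    quads  : ∀ {u v} → Link i j u v → len (𝒞 i) ≡ 4 → len (𝒞 j) ≡ 4 → Pair i j

  classify : ∀ {i j} → ProperlyInterconnected (𝒞 i) (𝒞 j) → Pair i j
  classify (inj₁ (v , v∈i , v∈j , only)) = seedˡ (touching v∈i v∈j only)
  classify {i} {j} (inj₂ (u , v , u≢v , u∈i , u∈j , v∈i , v∈j , only , consᵢ , consⱼ))
    with orient consᵢ | orient consⱼ
  ... | bᵢ , turnᵢ | bⱼ , turnⱼ = byLength (ext (𝒞 i)) (ext (𝒞 j)) refl refl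
    where
    link : Link i j u v
    link = record { u≢v = u≢v ; u∈i = u∈i ; u∈j = u∈j ; v∈i = v∈i ; v∈j = v∈j
                  ; only = only ; bᵢ = bᵢ ; bⱼ = bⱼ ; turnᵢ = turnᵢ ; turnⱼ = turnⱼ }
    exactly : ∀ {l} m → ext (𝒞 l) ≡ m → len (𝒞 l) ≡ 2 + m
    exactly m = cong (2 +_)
    exceeds : ∀ {l} c m → ext (𝒞 l) ≡ c + m → suc c < 2 + ext (𝒞 l)
    exceeds c m eq = s≤s (s≤s (subst (c ≤_) (sym eq) (ℕ.m≤m+n c m)))
    -- The numbers are lengths less two: 0, 1 and 2 stand for cycles of length 2, 3 and 4. `long`
    -- wants the cycle with at least five vertices in second place, hence the swapped link in the
    -- last case.
    byLength : ∀ a b → ext (𝒞 i) ≡ a → ext (𝒞 j) ≡ b → Pair i j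
    byLength 0 0 p q             = digons link (exactly 0 p) (exactly 0 q)
    byLength 0 (suc b) p q       = seedˡ (digon link (exactly 0 p) (exceeds 1 b q))
    byLength (suc a) 0 p q       = seedʳ (digon (Link-swap link) (exactly 0 q) (exceeds 1 a p))
    byLength 1 (suc b) p q       = seedˡ (triangle bᵢ u∈i (exactly 1 p))
    byLength (suc (suc a)) 1 p q = seedʳ (triangle bⱼ u∈j (exactly 1 q))
    byLength 2 2 p q             = quads link (exactly 2 p) (exactly 2 q)
    byLength (suc (suc a)) (suc (suc (suc b))) p q =
      seedˡ (long link (exceeds 1 (suc a) p) (exceeds 3 b q))
    byLength (suc (suc (suc a))) 2 p q =
      seedʳ (long (Link-swap link) (exceeds 1 1 q) (exceeds 3 a p))

  -- Escaping from pairs of digons and of 4-cycles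

  crowded : ∀ {m} (c : Cycle G) (xs : Vec (Fin n) m) → Unique xs → (∀ i → OnCycle (lookup xs i) c) → m ≤ len c
  crowded c xs unique on = injective⇒≤ {f = proj₁ ∘ on} (λ {i} {j} eq →
    lookup-injective unique i j (trans (sym (proj₂ (on i))) (trans (cong (vs c) eq) (proj₂ (on j)))))

  module _ (S : Subset k) where

    SeedIn : Set
    SeedIn = ∃ λ i → i ∈ S × Seed i

    -- Linked digons have the same two vertices. A walk through digons alone would never reach x, so
    -- some step of it has to yield a seed.
    walk-digon : ∀ {i l x} → PathIn 𝒞 S i l → i ∈ S → len (𝒞 i) ≡ 2 →
      ¬ OnCycle x (𝒞 i) → OnCycle x (𝒞 l) → SeedIn
    walk-digon here i∈S len≡2 x∉ x∈ = contradiction x∈ x∉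
    walk-digon {i} {l} {x} (step {j = j} pi j∈S rest) i∈S len≡2 x∉ x∈ with classify pi
    ... | seedˡ s = i , i∈S , s
    ... | seedʳ s = j , j∈S , s
    ... | quads _ len≡4 _ = contradiction (trans (sym len≡2) len≡4) λ ()
    ... | digons {u} {v} link _ len≡2′ = walk-digon rest j∈S len≡2′ x∉j x∈
      where
      x∉j : ¬ OnCycle x (𝒞 j)
      x∉j x∈j with digon-within (Link-swap link) len≡2′ x∈j
      ... | inj₁ refl = x∉ (Link.u∈i link)
      ... | inj₂ refl = x∉ (Link.v∈i link)

    -- d and d′ are the two vertices of 𝒞 i off 𝒞 j. They cannot both lie on 𝒞 l, which would then
    -- have the five vertices p, q, d, d′ and x. One that is off 𝒞 l serves in `third`; reversing
    -- the link exchanges their roles.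
    quad-seed : ∀ {i j l u v p q x} → Link i j u v → Link j l p q → len (𝒞 i) ≡ 4 → len (𝒞 j) ≡ 4 → len (𝒞 l) ≡ 4 →
      ¬ OnCycle x (𝒞 i) → ¬ OnCycle x (𝒞 j) → OnCycle x (𝒞 l) → Seed l
    quad-seed {i} {j} {l} {u} {v} {p} {q} {x} ij jl lenᵢ lenⱼ lenₗ x∉i x∉j x∈l = by (onCycle? (𝒞 l) d) (onCycle? (𝒞 l) d′)
      where
      open Link ij
      open Link jl using () renaming (u≢v to p≢q; u∈i to p∈j; v∈i to q∈j; u∈j to p∈l; v∈j to q∈l)
      d  = shift 𝒞 (i , bᵢ) v
      d′ = shift 𝒞 (i , not bᵢ) u
      power : ∀ m → 0 < m → m < 4 → ∀ b {y} → OnCycle y (𝒞 i) → ((i , b) ^^ m) · y ≢ y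
      power m 0<m m<4 b y∈i = aperiodic b m y∈i 0<m (subst (m <_) (sym lenᵢ) m<4)
      d∈i : OnCycle d (𝒞 i)
      d∈i = shift-on bᵢ v∈i
      d′∈i : OnCycle d′ (𝒞 i)
      d′∈i = shift-on (not bᵢ) u∈i
      Dd′≡u : shift 𝒞 (i , bᵢ) d′ ≡ u
      Dd′≡u = shift-flip (i , bᵢ) u
      d∉j : ¬ OnCycle d (𝒞 j)
      d∉j on with only d d∈i on
      ... | inj₁ eq = power 2 (s≤s z≤n) (ℕ.≤ᵇ⇒≤ _ _ _) bᵢ u∈i (trans (cong (shift 𝒞 (i , bᵢ)) turnᵢ) eq)
      ... | inj₂ eq = shift-moves bᵢ v∈i eq
      d′∉j : ¬ OnCycle d′ (𝒞 j)
      d′∉j on with only d′ d′∈i on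
      ... | inj₁ eq = shift-moves (not bᵢ) u∈i eq
      ... | inj₂ eq = power 2 (s≤s z≤n) (ℕ.≤ᵇ⇒≤ _ _ _) bᵢ v∈i
            (trans (cong (shift 𝒞 (i , bᵢ)) (trans (cong (shift 𝒞 (i , bᵢ)) (sym eq)) Dd′≡u)) turnᵢ)
      d≢d′ : d ≢ d′
      d≢d′ eq = power 3 (s≤s z≤n) (ℕ.≤ᵇ⇒≤ _ _ _) bᵢ u∈i
        (trans (cong (λ y → shift 𝒞 (i , bᵢ) (shift 𝒞 (i , bᵢ) y)) turnᵢ)
          (trans (cong (shift 𝒞 (i , bᵢ)) eq) Dd′≡u))
      differ : ∀ m {y z} → OnCycle y (𝒞 m) → ¬ OnCycle z (𝒞 m) → y ≢ z
      differ m y∈ z∉ refl = z∉ y∈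
      five : OnCycle d (𝒞 l) → OnCycle d′ (𝒞 l) → 5 ≤ len (𝒞 l)
      five d∈l d′∈l = crowded (𝒞 l) (p ∷ q ∷ d ∷ d′ ∷ x ∷ [])
        ( (p≢q ∷ differ j p∈j d∉j ∷ differ j p∈j d′∉j ∷ differ j p∈j x∉j ∷ [])
        ∷ (differ j q∈j d∉j ∷ differ j q∈j d′∉j ∷ differ j q∈j x∉j ∷ [])
        ∷ (d≢d′ ∷ differ i d∈i x∉i ∷ [])
        ∷ (differ i d′∈i x∉i ∷ [])
        ∷ [] ∷ [])
        λ { Fin.zero → p∈l ; (Fin.suc Fin.zero) → q∈l ; (Fin.suc (Fin.suc Fin.zero)) → d∈l
          ; (Fin.suc (Fin.suc (Fin.suc Fin.zero))) → d′∈l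
          ; (Fin.suc (Fin.suc (Fin.suc (Fin.suc Fin.zero)))) → x∈l }
      2<len : 2 < len (𝒞 i)
      2<len = subst (2 <_) (sym lenᵢ) (ℕ.≤ᵇ⇒≤ _ _ _)
      by : Dec (OnCycle d (𝒞 l)) → Dec (OnCycle d′ (𝒞 l)) → Seed l
      by (no d∉l) _ with reach true u∈j q∈j
      ... | m , m< , eq = third ij jl 2<len m (subst (m <_) lenⱼ m<) eq d∉l
      by (yes _) (no d′∉l) with reach true v∈j q∈j
      ... | m , m< , eq = third (Link-reverse ij) jl 2<len m (subst (m <_) lenⱼ m<) eq d′∉l
      by (yes d∈l) (yes d′∈l) = contradiction (subst (5 ≤_) lenₗ (five d∈l d′∈l)) (ℕ.<⇒≱ ℕ.≤-refl)

    -- The walk remembers the last two 4-cycles and that x is on neither. Unless a seed turns up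
    -- earlier, the first cycle that contains x is the third one for `quad-seed`.
    walk-quad : ∀ {i j l u v x} → PathIn 𝒞 S j l → j ∈ S → Link i j u v → len (𝒞 i) ≡ 4 → len (𝒞 j) ≡ 4 →
      ¬ OnCycle x (𝒞 i) → ¬ OnCycle x (𝒞 j) → OnCycle x (𝒞 l) → SeedIn
    walk-quad here _ _ _ _ _ x∉ x∈ = contradiction x∈ x∉
    walk-quad {j = j} {x = x} (step {j = m} pi m∈S rest) j∈S ij lenᵢ lenⱼ x∉i x∉j x∈ with classify pi
    ... | seedˡ s = j , j∈S , s
    ... | seedʳ s = m , m∈S , s
    ... | digons _ len≡2 _ = contradiction (trans (sym len≡2) lenⱼ) λ ()
    ... | quads jm _ lenₘ with onCycle? (𝒞 m) x
    ... | yes x∈m = m , m∈S , quad-seed ij jm lenᵢ lenⱼ lenₘ x∉i x∉j x∈m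
    ... | no x∉m  = walk-quad rest m∈S jm lenⱼ lenₘ x∉j x∉m x∈

    seedIn : 6 < n → (∀ i j → i ∈ S → j ∈ S → PathIn 𝒞 S i j) → (∀ v → ∃ λ i → i ∈ S × OnCycle v (𝒞 i)) →
      ∀ {i j} → i ∈ S → j ∈ S → ProperlyInterconnected (𝒞 i) (𝒞 j) → SeedIn
    seedIn 6<n paths cover {i} {j} i∈S j∈S pi with classify pi
    ... | seedˡ s = i , i∈S , s
    ... | seedʳ s = j , j∈S , s
    ... | digons {u} {v} link lenᵢ _ with fresh (u ∷ v ∷ []) (ℕ.≤-trans (ℕ.≤ᵇ⇒≤ 3 7 _) 6<n)
    ... | x , new with cover x
    ... | l , l∈S , x∈l = walk-digon (paths i l i∈S l∈S) i∈S lenᵢ x∉i x∈l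
      where
      x∉i : ¬ OnCycle x (𝒞 i)
      x∉i x∈i with digon-within link lenᵢ x∈i
      ... | inj₁ eq = new Fin.zero (sym eq)
      ... | inj₂ eq = new (Fin.suc Fin.zero) (sym eq)
    seedIn 6<n paths cover {i} {j} i∈S j∈S pi | quads {u} {v} link lenᵢ lenⱼ
      -- Two 4-cycles with a common edge have exactly these six vertices, so n > 6 leaves one
      -- outside.
      with fresh (u ∷ v ∷ s v ∷ s (s v) ∷ t v ∷ t (t v) ∷ []) 6<n
      where
      s = shift 𝒞 (i , Link.bᵢ link)
      t = shift 𝒞 (j , Link.bⱼ link)
    ... | x , new with cover x
    ... | l , l∈S , x∈l = walk-quad (paths j l j∈S l∈S) j∈S link lenᵢ lenⱼ x∉i x∉j x∈l
      where
      open Link link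
      quad : ∀ {m} b → len (𝒞 m) ≡ 4 → OnCycle u (𝒞 m) → shift 𝒞 (m , b) u ≡ v → OnCycle x (𝒞 m) →
        x ≢ u → x ≢ v → x ≢ shift 𝒞 (m , b) v → x ≡ shift 𝒞 (m , b) (shift 𝒞 (m , b) v)
      quad b len≡4 u∈ refl x∈ x≢u x≢v x≢w with reach b u∈ x∈
      ... | 0 , _ , eq = contradiction (sym eq) x≢u
      ... | 1 , _ , eq = contradiction (sym eq) x≢v
      ... | 2 , _ , eq = contradiction (sym eq) x≢w
      ... | 3 , _ , eq = sym eq
      ... | suc (suc (suc (suc m))) , m< , _ =
        contradiction (subst (4 + m <_) len≡4 m<) λ { (s≤s (s≤s (s≤s (s≤s ())))) }
      old : ∀ a → x ≢ lookup (u ∷ v ∷ shift 𝒞 (i , bᵢ) v ∷ shift 𝒞 (i , bᵢ) (shift 𝒞 (i , bᵢ) v)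
                       ∷ shift 𝒞 (j , bⱼ) v ∷ shift 𝒞 (j , bⱼ) (shift 𝒞 (j , bⱼ) v) ∷ []) a
      old a eq = new a (sym eq)
      x∉i : ¬ OnCycle x (𝒞 i)
      x∉i x∈i = old (# 3) (quad bᵢ lenᵢ u∈i turnᵢ x∈i (old (# 0)) (old (# 1)) (old (# 2)))
      x∉j : ¬ OnCycle x (𝒞 j)
      x∉j x∈j = old (# 5) (quad bⱼ lenⱼ u∈j turnⱼ x∈j (old (# 0)) (old (# 1)) (old (# 4)))

  record Generating : Set where
    field
      {a b c}   : Fin n
      word      : Word
      is3       : Is3 word a b c
      short     : length word ≤ 20
      all~      : ∀ u v → u ~ v

  generating : 6 < n → InducesPuzzle 𝒞 → Generating
  generating 6<n (S , (i , j , i≢j , i∈S , j∈S) , paths , cover) = by (start (paths i j i∈S j∈S))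
    where
    start : PathIn 𝒞 S i j → SeedIn S
    start here                = contradiction refl i≢j
    start (step pi m∈S _) = seedIn S 6<n paths cover i∈S m∈S pi
    by : SeedIn S → Generating
    by (l , l∈S , seed w is3 short con) = record { word = w ; is3 = is3 ; short = short ; all~ = all~ }
      where
      base : Fin n
      base = pos (𝒞 l) 0
      toBase : ∀ u → base ~ u
      toBase u with cover u
      ... | m , m∈S , u∈m = path-connected (paths l m l∈S m∈S) con (pos-on (𝒞 l) 0) u∈m
      all~ : ∀ u v → u ~ v
      all~ u v = ~-trans (~-sym (toBase u)) (toBase v)

-- Words of bounded length

module Bounded {n k : ℕ} {G : Graph n} (𝒞 : Fin k → Cycle G) (6<n : 6 < n) (gen : Configuration.Generating 𝒞) where
  open Configuration 𝒞
  open Generating gen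

  N : ℕ
  N = n * (n * n)

  M : ℕ
  M = N + (20 + N)

  -- A word longer than the number N of triples visits some triple twice and can be cut there.
  opaque
    shortcut : ∀ x y z w → ∃ λ w′ → length w′ ≤ N × w′ · x ≡ w · x × w′ · y ≡ w · y × w′ · z ≡ w · z
    shortcut x y z w = go (length w) w ℕ.≤-refl
      where
      Good : Word → Set
      Good w = ∃ λ w′ → length w′ ≤ N × w′ · x ≡ w · x × w′ · y ≡ w · y × w′ · z ≡ w · z
      code : Word → Fin N
      code w = combine (w · x) (combine (w · y) (w · z))
      go : ∀ m w → length w ≤ m → Good w
      go m w len≤m with length w ℕ.≤? N
      ... | yes len≤N = w , len≤N , refl , refl , refl
      go zero    w len≤m | no len≰N = contradiction (ℕ.≤-trans len≤m z≤n) len≰N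
      -- Letters act from the right, so the suffixes of w, one more than its letters, give the
      -- successive positions of the triple. The letters between two suffixes of equal code are
      -- removed.
      go (suc m) w len≤m | no len≰N with pigeonhole (ℕ.m≤n⇒m≤1+n (ℕ.≰⇒> len≰N)) (λ (i : Fin (suc (length w))) → code (drop (toℕ i) w))
      ... | i , j , i<j , eq with go m (take (toℕ i) w ++ drop (toℕ j) w) shorter
        where
        shorter : length (take (toℕ i) w ++ drop (toℕ j) w) ≤ m
        shorter = ℕ.≤-pred (begin-strict
          length (take (toℕ i) w ++ drop (toℕ j) w)           ≡⟨ length-++ (take (toℕ i) w) ⟩
          length (take (toℕ i) w) + length (drop (toℕ j) w)   ≡⟨ cong₂ _+_ (length-take (toℕ i) w) (length-drop (toℕ j) w) ⟩
          toℕ i ⊓ length w + (length w ∸ toℕ j)      ≤⟨ ℕ.+-monoˡ-≤ _ (ℕ.m⊓n≤m (toℕ i) _) ⟩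
          toℕ i + (length w ∸ toℕ j)                          <⟨ ℕ.+-monoˡ-< _ i<j ⟩
          toℕ j + (length w ∸ toℕ j)                          ≡⟨ ℕ.m+[n∸m]≡n (ℕ.≤-pred (toℕ<n j)) ⟩
          length w                                            ≤⟨ len≤m ⟩
          suc m                                               ∎)
          where open ℕ.≤-Reasoning
      ... | w′ , short′ , eqx , eqy , eqz
        with combine-injective (drop (toℕ i) w · x) _ (drop (toℕ j) w · x) _ eq
      ... | eq₁ , eq₂₃
        with combine-injective (drop (toℕ i) w · y) (drop (toℕ i) w · z) (drop (toℕ j) w · y) (drop (toℕ j) w · z) eq₂₃
      ... | eq₂ , eq₃ =
        w′ , short′ , trans eqx (cut eq₁) , trans eqy (cut eq₂) , trans eqz (cut eq₃)
        where
        cut : ∀ {v} → drop (toℕ i) w · v ≡ drop (toℕ j) w · v → (take (toℕ i) w ++ drop (toℕ j) w) · v ≡ w · v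
        cut {v} same-v = begin
          (take (toℕ i) w ++ drop (toℕ j) w) · v ≡⟨ ·-++ (take (toℕ i) w) _ v ⟩
          take (toℕ i) w · drop (toℕ j) w · v    ≡⟨ cong (take (toℕ i) w ·_) same-v ⟨
          take (toℕ i) w · drop (toℕ i) w · v    ≡⟨ ·-++ (take (toℕ i) w) _ v ⟨
          (take (toℕ i) w ++ drop (toℕ i) w) · v ≡⟨ cong (_· v) (take++drop≡id (toℕ i) w) ⟩
          w · v                                  ∎
          where open ≡-Reasoning

  opaque
    -- A 3-cycle (p q t) does it, with t outside p, q, r and s.
    move : ∀ p q r s → p ≢ r → p ≢ s → q ≢ r → q ≢ s → ∃ λ w → w · p ≡ q × w · r ≡ r × w · s ≡ s
    move p q r s p≢r p≢s q≢r q≢s with p ≟ᶠ q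
    ... | yes refl = [] , refl , refl , refl
    ... | no p≢q with fresh (p ∷ q ∷ r ∷ s ∷ []) (ℕ.≤-trans (ℕ.≤ᵇ⇒≤ 5 7 _) 6<n)
    ... | t , new with allTri all~ p q t p≢q (new (# 1)) (new (# 0) ∘ sym)
    ... | w , threeCycle _ _ _ pq _ _ fix =
      w , pq , fix r (p≢r ∘ sym) (q≢r ∘ sym) (new (# 2)) , fix s (p≢s ∘ sym) (q≢s ∘ sym) (new (# 3))

  opaque
    transit : ∀ x y z p q r → x ≢ y → y ≢ z → z ≢ x → p ≢ q → q ≢ r → r ≢ p →
      ∃ λ w → w · x ≡ p × w · y ≡ q × w · z ≡ r
    transit x y z p q r x≢y y≢z z≢x p≢q q≢r r≢p
      with fresh (x ∷ p ∷ []) (ℕ.≤-trans (ℕ.≤ᵇ⇒≤ 3 7 _) 6<n)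
    -- `move` always keeps two points. While fewer have been placed, the spare slots are filled: by
    -- a fresh t here, by a second p in the next move.
    ... | t , new with move x p t t (new (# 0)) (new (# 0)) (new (# 1)) (new (# 1))
    ... | f , fx≡p , _ with move (f · y) q p p fy≢p fy≢p (p≢q ∘ sym) (p≢q ∘ sym)
      where
      fy≢p : f · y ≢ p
      fy≢p eq = x≢y (·-injective f (trans fx≡p (sym eq)))
    ... | g , gfy≡q , gp≡p , _ with move (g · f · z) r p q
        (λ eq → z≢x (·-injective f (·-injective g (trans eq (trans (sym gp≡p) (cong (g ·_) (sym fx≡p)))))))
        (λ eq → y≢z (·-injective f (·-injective g (trans gfy≡q (sym eq)))))
        r≢p (q≢r ∘ sym)
    ... | h , hgfz≡r , hp≡p , hq≡q =
        h ++ g ++ f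
      , trans (unfold x) (trans (cong (λ v → h · g · v) fx≡p) (trans (cong (h ·_) gp≡p) hp≡p))
      , trans (unfold y) (trans (cong (h ·_) gfy≡q) hq≡q)
      , trans (unfold z) hgfz≡r
      where
      unfold : ∀ v → (h ++ g ++ f) · v ≡ h · g · f · v
      unfold v = trans (·-++ h _ v) (cong (h ·_) (·-++ g f v))

  opaque
    -- `allTri` has no length bound; it enters only through `transit`, which supplies a conjugator
    -- for `shortcut` to shorten.
    triShort : ∀ p q r → p ≢ q → q ≢ r → r ≢ p → ∃ λ w → Is3 w p q r × length w ≤ M
    triShort p q r p≢q q≢r r≢p with transit a b c p q r
      (is3 .IsThreeCycle.a≢b) (is3 .IsThreeCycle.b≢c) (is3 .IsThreeCycle.c≢a) p≢q q≢r r≢p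
    ... | g , refl , refl , refl with shortcut a b c g
    ... | g′ , g′≤N , eqa , eqb , eqc =
        conj g′ word
      , subst (Is3 (conj g′ word) (g · a) (g · b)) eqc
          (subst₂ (λ u v → Is3 (conj g′ word) u v (g′ · c)) eqa eqb (Is3-conj g′ {word} is3))
      , ℕ.≤-trans (ℕ.≤-reflexive (length-conj g′ word)) (ℕ.+-mono-≤ g′≤N (ℕ.+-mono-≤ short g′≤N))

  opaque
    wordChain : ∀ p q r → p ≢ q → q ≢ r →
      ∃ λ w → (∀ v → w · v ≡ PC.transpose p q (PC.transpose q r v)) × length w ≤ M
    wordChain p q r p≢q q≢r with r ≟ᶠ p
    ... | yes refl = [] , (λ v → sym (PC.transpose-inverse p q)) , z≤n
    ... | no r≢p with triShort p q r p≢q q≢r r≢p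
    ... | w , is , w≤M = w , threeCycle-unique is (transpose-transpose p≢q q≢r r≢p) , w≤M

  opaque
    -- Insert (q r)(q r) between the two transpositions: (p q)(q r) and (q r)(r s) are chains.
    -- `wordChain` allows equal end points, so overlaps such as r = p or s = q need no separate
    -- care.
    wordPair : ∀ p q r s → p ≢ q → r ≢ s →
      ∃ λ w → (∀ v → w · v ≡ PC.transpose p q (PC.transpose r s v)) × length w ≤ M + M
    wordPair p q r s p≢q r≢s with q ≟ᶠ r
    ... | yes refl with wordChain p q s p≢q r≢s
    ... | w , eq , w≤M = w , eq , ℕ.≤-trans w≤M (ℕ.m≤m+n M M)
    wordPair p q r s p≢q r≢s | no q≢r with wordChain p q r p≢q q≢r | wordChain q r s q≢r r≢s
    ... | w , eq , w≤M | w′ , eq′ , w′≤M =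
        w ++ w′
      , (λ v → trans (·-++ w w′ v) (trans (eq _) (cong (PC.transpose p q)
          (trans (cong (PC.transpose q r) (eq′ v)) (transpose-involutive q r (PC.transpose r s v))))))
      , ℕ.≤-trans (ℕ.≤-reflexive (length-++ w)) (ℕ.+-mono-≤ w≤M w′≤M)

  opaque
    evenWord : ∀ t → AllDistinctPairs t → length t % 2 ≡ 0 →
      ∃ λ w → (∀ v → w · v ≡ composeTranspositions t v) × length w ≤ length t * M
    evenWord [] _ _ = [] , (λ _ → refl) , z≤n
    evenWord ((p , q) ∷ (r , s) ∷ t) (p≢q ∷ r≢s ∷ dt) even with wordPair p q r s p≢q r≢s | evenWord t dt even
    ... | w , eq , w≤ | w′ , eq′ , w′≤ =
        w ++ w′
      , (λ v → trans (·-++ w w′ v) (trans (eq _) (cong (PC.transpose p q ∘ PC.transpose r s) (eq′ v))))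
      , ℕ.≤-trans (ℕ.≤-reflexive (length-++ w))
          (ℕ.≤-trans (ℕ.+-mono-≤ w≤ w′≤) (ℕ.≤-reflexive (ℕ.+-assoc M M _)))

  -- The bound 2n on the list leaves room for two decompositions joined together, as
  -- `even-or-oddShift` produces.
  record OddShift : Set where
    field
      s        : Shift 𝒞
      t        : List (Fin n × Fin n)
      distinct : AllDistinctPairs t
      odd      : length t % 2 ≡ 1
      t≤       : length t ≤ n + n
      acts     : ∀ v → composeTranspositions t v ≡ shift 𝒞 s v

  bound : ℕ
  bound = 1 + (n + n + n) * M

  evenBounded : ∀ (π : Permutation′ n) t → AllDistinctPairs t → length t % 2 ≡ 0 → length t ≤ n →
    (∀ v → composeTranspositions t v ≡ π ⟨$⟩ʳ v) → ∃ λ w → Generates 𝒞 w π × length w ≤ bound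
  evenBounded π t dt even t≤n eq with evenWord t dt even
  ... | w , acts , w≤ = w , (λ v → trans (acts v) (eq v))
    , ℕ.m≤n⇒m≤1+n (ℕ.≤-trans w≤ (ℕ.*-monoˡ-≤ M (ℕ.≤-trans t≤n (ℕ.m≤n+m n (n + n)))))

  oddShift⇒bounded : OddShift → ∀ π → ∃ λ w → Generates 𝒞 w π × length w ≤ bound
  oddShift⇒bounded o π with transpositions π
  ... | t , dt , t≤n , eq with %2-cases (length t)
  ... | inj₁ even = evenBounded π t dt even t≤n eq
  -- The list stands for s⁻¹π, which is even; the letter s is put back in front. Its length, at most
  -- 2n + n, is the origin of the factor 3n in `bound`.
  ... | inj₂ odd with evenWord (rev o.t ++ t) (distinct-++ (distinct-rev o.distinct) dt) even
    where
    module o = OddShift o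
    even : length (rev o.t ++ t) % 2 ≡ 0
    even = trans (cong (_% 2) (length-++ (rev o.t)))
      (trans (odd-+ (length (rev o.t)) (trans (cong (_% 2) (length-rev o.t)) o.odd)) (suc-odd (length t) odd))
  ... | w , acts , w≤ = o.s ∷ w , gen-π , s≤s (ℕ.≤-trans w≤ (ℕ.*-monoˡ-≤ M t′≤))
    where
    module o = OddShift o
    t′≤ : length (rev o.t ++ t) ≤ n + n + n
    t′≤ = ℕ.≤-trans (ℕ.≤-reflexive (trans (length-++ (rev o.t)) (cong (_+ length t) (length-rev o.t))))
      (ℕ.+-mono-≤ o.t≤ t≤n)
    gen-π : Generates 𝒞 (o.s ∷ w) π
    gen-π v = begin
      shift 𝒞 o.s (w · v)                                      ≡⟨ o.acts (w · v) ⟨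
      composeTranspositions o.t (w · v)                        ≡⟨ cong (composeTranspositions o.t) (acts v) ⟩
      composeTranspositions o.t (composeTranspositions (rev o.t ++ t) v)
        ≡⟨ cong (composeTranspositions o.t) (compose-++ (rev o.t) t v) ⟩
      composeTranspositions o.t (composeTranspositions (rev o.t) (composeTranspositions t v))
        ≡⟨ compose-rev′ o.t _ ⟩
      composeTranspositions t v                                ≡⟨ eq v ⟩
      π ⟨$⟩ʳ v                                                 ∎
      where open ≡-Reasoning

  perm : Word → Permutation′ n
  perm w = permutation (w ·_) (w ⁻¹ ·_) (inverseʳ w) (inverseˡ w)

  -- The first letter of a word at which the parity of the canonical decompositions changes is odd;
  -- this avoids showing that the sign of a permutation is well defined.
  even-or-oddShift : ∀ w → (∃ λ t → AllDistinctPairs t × length t % 2 ≡ 0 × length t ≤ n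
    × (∀ v → composeTranspositions t v ≡ w · v)) ⊎ OddShift
  even-or-oddShift [] = inj₁ ([] , [] , refl , z≤n , λ _ → refl)
  even-or-oddShift (s ∷ w) with even-or-oddShift w
  ... | inj₂ o = inj₂ o
  ... | inj₁ (t , dt , even , t≤n , eq) with transpositions (perm (s ∷ w))
  ... | t′ , dt′ , t′≤n , eq′ with %2-cases (length t′)
  ... | inj₁ even′ = inj₁ (t′ , dt′ , even′ , t′≤n , eq′)
  ... | inj₂ odd′ = inj₂ (record
    -- This list represents the product of s w and w⁻¹, that is, s itself.
    { s = s ; t = t′ ++ rev t ; distinct = distinct-++ dt′ (distinct-rev dt)
    ; odd = trans (cong (_% 2) length≡) (trans (odd-+ (length t′) odd′) (suc-even (length t) even))
    ; t≤ = ℕ.≤-trans (ℕ.≤-reflexive length≡) (ℕ.+-mono-≤ t′≤n t≤n)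
    ; acts = λ v → trans (compose-++ t′ _ v) (trans (eq′ _)
        (cong (shift 𝒞 s) (trans (sym (eq _)) (compose-rev′ t v)))) })
    where
    length≡ : length (t′ ++ rev t) ≡ length t′ + length t
    length≡ = trans (length-++ t′) (cong (length t′ +_) (length-rev t))

  bounded : ∀ π → InConfigGroup 𝒞 π → ∃ λ w → Generates 𝒞 w π × length w ≤ bound
  bounded π (w , gen-w) with even-or-oddShift w
  ... | inj₁ (t , dt , even , t≤n , eq) = evenBounded π t dt even t≤n (λ v → trans (eq v) (gen-w v))
  ... | inj₂ o = oddShift⇒bounded o π

  even⇒generated : ∀ π → IsEven π → InConfigGroup 𝒞 π
  even⇒generated π (t , dt , even , eq) with evenWord t dt even
  ... | w , acts , _ = w , λ v → trans (acts v) (eq v)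

  even-cycle⇒oddShift : ∀ i → len (𝒞 i) % 2 ≡ 0 → OddShift
  even-cycle⇒oddShift i even = record
    { s = i , true ; t = path (𝒞 i) last ; distinct = distinct-path (𝒞 i) last
    ; odd = trans (cong (_% 2) (length-path (𝒞 i) last)) (suc-even (ext (𝒞 i)) even)
    ; t≤ = ℕ.≤-trans (ℕ.≤-reflexive (length-path (𝒞 i) last))
        (ℕ.≤-trans (ℕ.n≤1+n last) (ℕ.≤-trans (len≤n (𝒞 i)) (ℕ.m≤m+n n n)))
    ; acts = cyclePerm-transpositions (𝒞 i) }
    where
    last = suc (ext (𝒞 i))

  bound≤ : bound ≤ 67 * n ^ 5
  bound≤ = polynomial-bound n {{>-nonZero (ℕ.≤-<-trans z≤n 6<n)}}

-- Cycles of odd length generate only even permutations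

module _ {n k : ℕ} {G : Graph n} (𝒞 : Fin k → Cycle G) where
  open Configuration 𝒞

  generated⇒even : (∀ i → OddNat (len (𝒞 i))) → ∀ w → ∃ λ t → AllDistinctPairs t × length t % 2 ≡ 0
    × (∀ v → composeTranspositions t v ≡ w · v)
  generated⇒even odd [] = [] , [] , refl , λ _ → refl
  generated⇒even odd (s ∷ w) with turn s | generated⇒even odd w
    where
    Even : Shift 𝒞 → Set
    Even s = ∃ λ t → AllDistinctPairs t × length t % 2 ≡ 0 × (∀ v → composeTranspositions t v ≡ shift 𝒞 s v)
    turn : ∀ s → Even s
    turn (i , true) = path (𝒞 i) last , distinct-path (𝒞 i) last
      , trans (cong (_% 2) (length-path (𝒞 i) last)) (suc-odd (ext (𝒞 i)) (odd i))
      , cyclePerm-transpositions (𝒞 i)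
      where last = suc (ext (𝒞 i))
    turn (i , false) with turn (i , true)
    ... | t , dt , even , eq = rev t , distinct-rev dt , trans (cong (_% 2) (length-rev t)) even
      , λ v → trans (cong (composeTranspositions (rev t)) (sym (trans (eq _) (cyclePerm-cyclePermInv (𝒞 i) v))))
                (compose-rev t _)
  ... | t , dt , even , eq | t′ , dt′ , even′ , eq′ =
      t ++ t′ , distinct-++ dt dt′
    , trans (cong (_% 2) (length-++ t)) (trans (even-+ (length t) even) even′)
    , λ v → trans (compose-++ t t′ v) (trans (eq _) (cong (shift 𝒞 s) (eq′ v)))

theorem3 : Σ ℕ λ c →
    ∀ (n : ℕ) (G : Graph n) (k : ℕ) (𝒞 : Fin k → Cycle G) →
    6 < n → InducesPuzzle 𝒞 →
    ((∀ i → OddNat (len (𝒞 i))) →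
    ∀ (π : Permutation′ n) → InConfigGroup 𝒞 π ⇔ IsEven π)
    × (¬ (∀ i → OddNat (len (𝒞 i))) →
    ∀ (π : Permutation′ n) → InConfigGroup 𝒞 π)
    × (∀ (π : Permutation′ n) → InConfigGroup 𝒞 π →
    ∃ λ w → Generates 𝒞 w π × length w ≤ c * n ^ 5)
theorem3 = 67 , λ n G k 𝒞 6<n puzzle → let open Bounded 𝒞 6<n (Configuration.generating 𝒞 6<n puzzle) in
    (λ odd π → mk⇔
      (λ (w , gen-w) → let t , dt , even , eq = generated⇒even 𝒞 odd w in
        t , dt , even , λ v → trans (eq v) (gen-w v))
      (even⇒generated π))
  , (λ notAllOdd π →
      let i , notOdd = ¬∀⟶∃¬ k _ (λ i → len (𝒞 i) % 2 ℕ.≟ 1) notAllOdd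
          even       = [ id , (λ odd → contradiction odd notOdd) ]′ (%2-cases (len (𝒞 i)))
          w , gen-w , _ = oddShift⇒bounded (even-cycle⇒oddShift i even) π
      in w , gen-w)
  , λ π inGroup →
      let w , gen-w , w≤ = bounded π inGroup
      in w , gen-w , ℕ.≤-trans w≤ bound≤
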